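{- Let $F$ be a Ferrers shape and fix a filling of $F$ with non-negative integers. Complete it to a labelling of the corners of $F$ by partitions according to dual RSK' (as described in the context). Let $c=(x,y)$ be a corner of a cell of $F$, let $\lambda=(\lambda_1,\dots,\lambda_\ell)$ be the partition labelling $c$, with conjugate $\lambda'$, and let $R_c$ be the set of cells of $F$ in columns $\le x$ and rows $\le y$. Then: (1) for every $k\ge1$, considering collections of $k$ ne-chains in $R_c$ such that no cell with entry $e$ lies in more than $e$ of the chains, the maximal cardinality of the multiset union of the chains in such a collection equals $\lambda_1+\dots+\lambda_k$; (2) for every $k\ge1$, the maximal sum of all entries in a collection of $k$ pairwise disjoint SE-chains in $R_c$ equals $\lambda'_1+\dots+\lambda'_k$. In particular $\lambda_1$ is the length of the longest ne-chain in $R_c$ and $\lambda'_1$ is the length of the longest SE-chain in $R_c$.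
   Context: A Ferrers shape (French notation) has columns $1,\dots,m$ from left to right and rows numbered from the bottom; column $j$ consists of the cells in rows $1,\dots,h_j$, with $h_1\ge\dots\ge h_m\ge1$. The cell in column $j$, row $i$ has corners $(j-1,i-1),(j,i-1),(j-1,i),(j,i)$. Partitions are identified with Ferrers diagrams; $\mu\cup\nu$ is the componentwise maximum. Growth diagrams. Let $G$ be a Ferrers shape with a $0$-$1$-filling having at most one $1$ in each row and each column. Label every corner on the left and bottom sides of $G$ by $\emptyset$ and determine the other labels cell by cell: for a cell with bottom-left label $\rho$, bottom-right $\mu$, top-left $\nu$, the top-right label $\lambda$ is: (F1) if $\rho=\mu=\nu$ and the cell contains $0$, $\lambda=\rho$; (F2) if $\rho=\mu\ne\nu$, $\lambda=\nu$; (F3) if $\rho=\nu\ne\mu$, $\lambda=\mu$; (F4) if $\rho,\mu,\nu$ are pairwise distinct, $\lambda=\mu\cup\nu$; (F5) if $\rho\ne\mu=\nu$ and $\mu,\rho$ differ in row $k$, $\lambda$ is $\mu$ with a square added in row $k+1$; (F6) if $\rho=\mu=\nu$ and the cell contains $1$, $\lambda$ is $\rho$ with a square added to the first row. Dual RSK'. Given a filling of $F$ with non-negative integers, let $c_j$ be the sum of entries in column $j$ and $r_i$ the sum in row $i$. Replace each entry $m$ of a cell by $m$ units $u_1,\dots,u_m$. Build a Ferrers shape $G$ by replacing column $j$ by a block of $\max(c_j,1)$ columns and row $i$ by a block of $\max(r_i,1)$ rows, a cell of $G$ in column block $j$ and row block $i$ belonging to $G$ iff cell (column $j$, row $i$)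 belongs to $F$. The units of column $j$, listed by cells from top to bottom and within a cell as $u_1,\dots,u_m$, are assigned to the columns of block $j$ from left to right; the units of row $i$, listed by cells from left to right and within a cell as $u_1,\dots,u_m$, are assigned to the rows of block $i$ from top to bottom. Each unit becomes a $1$ in the cell of $G$ given by its assigned column and row (so all separations go from top-left to bottom-right). Compute the growth diagram of $G$; the label of corner $(x,y)$ of $F$ is the label of the corner of $G$ at the right end of column block $x$ and the top end of row block $y$. Chains: an ne-chain is a sequence of cells with nonzero entries, each strictly above and strictly to the right of the preceding one; its length is the number of its cells. An SE-chain is a sequence of distinct cells with nonzero entries, each weakly below and weakly to the right of the preceding one; its length is the sum of its entries. -}

module Defs where

open import Data.Nat using (ℕ; zero; suc; pred; _+_; _*_; _∸_; _≤_; _<_; _⊔_; _≤?_; _≟_)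
open import Data.Bool using (Bool; true; false; if_then_else_; _∧_)
open import Data.List using (List; []; _∷_; length; take; map; filter; upTo)
open import Data.Nat.ListAction using (sum)
open import Data.List.Properties using (≡-dec)
open import Data.List.Relation.Unary.All using (All)
open import Data.List.Relation.Unary.Linked using (Linked)
open import Data.List.Relation.Unary.Unique.Propositional using (Unique)
open import Data.List.Membership.Propositional using (_∈_)
open import Data.List.Membership.DecPropositional using () renaming (_∈?_ to ∈?-gen)
import Data.Product.Properties as PP
open import Data.Product using (_×_; _,_; ∃; Σ)
open import Data.Sum using (_⊎_)
open import Data.Fin using (Fin)
open import Data.Vec using (Vec; lookup; toList)
open import Relation.Nullary using (does; ¬_)
open import Relation.Binary.PropositionalEquality using (_≡_; _≢_)

-- Partitions: weakly decreasing lists of positive parts (λ₁ ∷ λ₂ ∷ …).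

Partition : Set
Partition = List ℕ

_≟ₚ_ : (a b : Partition) → Bool
a ≟ₚ b = does (≡-dec _≟_ a b)

_∪ₚ_ : Partition → Partition → Partition
[] ∪ₚ ys = ys
(x ∷ xs) ∪ₚ [] = x ∷ xs
(x ∷ xs) ∪ₚ (y ∷ ys) = (x ⊔ y) ∷ (xs ∪ₚ ys)

addSq : ℕ → Partition → Partition
addSq zero [] = 1 ∷ []
addSq zero (a ∷ as) = suc a ∷ as
addSq (suc k) [] = 0 ∷ addSq k []
addSq (suc k) (a ∷ as) = a ∷ addSq k as

-- 0-indexed first row in which two partitions differ (missing parts are 0)
firstDiff : Partition → Partition → ℕ
firstDiff [] [] = 0
firstDiff [] (b ∷ bs) = if does (b ≟ 0) then suc (firstDiff [] bs) else 0
firstDiff (a ∷ as) [] = if does (a ≟ 0) then suc (firstDiff as []) else 0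
firstDiff (a ∷ as) (b ∷ bs) = if does (a ≟ b) then suc (firstDiff as bs) else 0

conj : Partition → Partition
conj [] = []
conj (a ∷ as) = map (λ i → length (filter (λ b → suc i ≤? b) (a ∷ as))) (upTo a)

partSum : ℕ → Partition → ℕ
partSum k p = sum (take k p)

-- Growth diagrams (local rules F1–F6).
-- localRule ρ μ ν e : ρ bottom-left, μ bottom-right, ν top-left, e entry of the cell.

localRule : Partition → Partition → Partition → ℕ → Partition
localRule ρ μ ν e =
  if (ρ ≟ₚ μ) ∧ (ρ ≟ₚ ν)
    then (if does (e ≟ 0) then ρ else addSq 0 ρ)
    else (if ρ ≟ₚ μ then ν
    else (if ρ ≟ₚ ν then μ
    else (if μ ≟ₚ ν then addSq (suc (firstDiff μ ρ)) μ
    else (μ ∪ₚ ν))))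

-- growth g X Y : label of corner (X,Y) of the growth diagram of the 0-1 filling g
-- (g X Y = entry of the cell in column X, row Y, 1-indexed; cell (X,Y) has
-- top-right corner (X,Y)).  Left and bottom sides are labelled ∅.
growth : (ℕ → ℕ → ℕ) → ℕ → ℕ → Partition
growth g zero y = []
growth g (suc x) zero = []
growth g (suc x) (suc y) =
  localRule (growth g x y) (growth g (suc x) y) (growth g x (suc y)) (g (suc x) (suc y))

-- Ferrers shapes (French notation), given by the list of column heights h₁ … hₘ.

sumTo : ℕ → (ℕ → ℕ) → ℕ
sumTo zero f = 0
sumTo (suc n) f = sumTo n f + f (suc n)

-- h_j (1-indexed; 0 for j = 0 or j > m)
heightAt : List ℕ → ℕ → ℕ
heightAt hs zero = 0
heightAt [] (suc j) = 0
heightAt (h ∷ hs) (suc zero) = h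
heightAt (h ∷ hs) (suc (suc j)) = heightAt hs (suc j)

IsFerrers : List ℕ → Set
IsFerrers hs = All (1 ≤_) hs × Linked (λ a b → b ≤ a) hs

Cell : Set
Cell = ℕ × ℕ   -- (column j , row i)

InF : List ℕ → Cell → Set
InF hs (j , i) = 1 ≤ i × i ≤ heightAt hs j

IsCorner : List ℕ → ℕ → ℕ → Set
IsCorner hs x y = ∃ λ j → ∃ λ i → InF hs (j , i) × (x ≡ j ⊎ suc x ≡ j) × (y ≡ i ⊎ suc y ≡ i)

-- A filling with non-negative integers: f j i = entry of cell (column j, row i);
-- values outside F are ignored.
Filling : Set
Filling = ℕ → ℕ → ℕ

module DualRSK (hs : List ℕ) (f : Filling) where

  m : ℕ
  m = length hs

  ent : ℕ → ℕ → ℕ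
  ent j i = if does (i ≤? heightAt hs j) then f j i else 0

  colSum : ℕ → ℕ
  colSum j = sumTo (heightAt hs j) (λ i → ent j i)

  rowSum : ℕ → ℕ
  rowSum i = sumTo m (λ j → ent j i)

  -- right end of column block x / top end of row block y
  Xend : ℕ → ℕ
  Xend x = sumTo x (λ j → colSum j ⊔ 1)

  Yend : ℕ → ℕ
  Yend y = sumTo y (λ i → rowSum i ⊔ 1)

  -- column of G of unit u_t (t = 1 … f j i) of cell (j,i): units of column j are
  -- listed from the top cell downwards, assigned left to right
  unitCol : ℕ → ℕ → ℕ → ℕ
  unitCol j i t = Xend (pred j) + (colSum j ∸ sumTo i (λ i' → ent j i')) + t

  -- row of G of unit u_t of cell (j,i): units of row i are listed from the left
  -- cell rightwards, assigned top to bottom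
  unitRow : ℕ → ℕ → ℕ → ℕ
  unitRow j i t = suc (Yend i) ∸ (sumTo (pred j) (λ j' → ent j' i) + t)

  -- the 0-1 filling of G (number of units placed in cell (X,Y) of G)
  gFill : ℕ → ℕ → ℕ
  gFill X Y =
    sumTo m (λ j → sumTo (heightAt hs j) (λ i → sumTo (ent j i) (λ t →
      if does (unitCol j i t ≟ X) ∧ does (unitRow j i t ≟ Y) then 1 else 0)))

  label : ℕ → ℕ → Partition
  label x y = growth gFill (Xend x) (Yend y)

dualRSKLabel : List ℕ → Filling → ℕ → ℕ → Partition
dualRSKLabel hs f = DualRSK.label hs f

InR : List ℕ → ℕ → ℕ → Cell → Set
InR hs x y (j , i) = InF hs (j , i) × j ≤ x × i ≤ y

entryOf : Filling → Cell → ℕ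
entryOf f (j , i) = f j i

GoodCell : List ℕ → Filling → ℕ → ℕ → Cell → Set
GoodCell hs f x y c = InR hs x y c × entryOf f c ≢ 0

IsNEChain : List ℕ → Filling → ℕ → ℕ → List Cell → Set
IsNEChain hs f x y cs =
  All (GoodCell hs f x y) cs × Linked (λ { (j , i) (j' , i') → j < j' × i < i' }) cs

IsSEChain : List ℕ → Filling → ℕ → ℕ → List Cell → Set
IsSEChain hs f x y cs =
  All (GoodCell hs f x y) cs × Linked (λ { (j , i) (j' , i') → j ≤ j' × i' ≤ i }) cs × Unique cs

seLength : Filling → List Cell → ℕ
seLength f cs = sum (map (entryOf f) cs)

_∈?ᶜ_ : (c : Cell) (cs : List Cell) → Bool
c ∈?ᶜ cs = does (∈?-gen (PP.≡-dec _≟_ _≟_) c cs)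

multiplicity : ∀ {k} → Cell → Vec (List Cell) k → ℕ
multiplicity c chs = length (filter (λ cs → ∈?-gen (PP.≡-dec _≟_ _≟_) c cs) (toList chs))

NECollection : List ℕ → Filling → ℕ → ℕ → (k : ℕ) → Vec (List Cell) k → Set
NECollection hs f x y k chs =
  (∀ p → IsNEChain hs f x y (lookup chs p)) × (∀ c → multiplicity c chs ≤ entryOf f c)

SECollection : List ℕ → Filling → ℕ → ℕ → (k : ℕ) → Vec (List Cell) k → Set
SECollection hs f x y k chs =
  (∀ p → IsSEChain hs f x y (lookup chs p)) ×
  (∀ (p q : Fin k) → p ≢ q → ∀ c → c ∈ lookup chs p → ¬ (c ∈ lookup chs q))

MaxOf : {A : Set} → (A → Set) → (A → ℕ) → ℕ → Set
MaxOf {A} P val n = (Σ A λ a → P a × val a ≡ n) × (∀ a → P a → val a ≤ n)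

{-# OPTIONS --safe #-}
module Submission where

-- Along a column of the growth diagram, a square added in row r between heights y − 1 and y
-- says that y is in row r of a tableau.  The local rules then turn one column into the next
-- by row insertion, i.e. by Knuth moves on the reading word (rows from top to bottom), and
-- these moves transport k disjoint increasing (or decreasing) subsequences.  The rows and
-- the columns of the last tableau give k increasing subsequences with λ₁ + … + λₖ letters
-- and l decreasing ones with λ′₁ + … + λ′ₗ letters; on cells they become ne-chains and
-- SE-chains, so both maxima are at least as large as claimed.
--
-- Conversely an ne-chain and an SE-chain share at most one cell, so k ne-chains and l
-- disjoint SE-chains have total size at most |λ| + kl.  If the k × l rectangle touches the
-- boundary of λ, then λ₁ + … + λₖ + λ′₁ + … + λ′ₗ = |λ| + kl, so neither can be exceeded.

open import Defs
open import Data.Bool using (Bool; true; false; if_then_else_; _∧_)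
open import Data.Empty using (⊥-elim)
open import Data.Fin using (Fin; zero; suc)
open import Data.List using (List; []; _∷_; length; _++_; map; reverse; [_]; concat; filter; upTo; applyUpTo; deduplicate)
open import Data.List.Membership.DecPropositional using () renaming (_∈?_ to ∈?-gen)
open import Data.List.Membership.Propositional using (_∈_; _∉_)
open import Data.List.Membership.Propositional.Properties using (∈-++⁺ˡ; ∈-++⁺ʳ; ∈-++⁻; ∈-map⁺; ∈-map⁻; ∈-filter⁻; ∈-upTo⁺; ∈-upTo⁻; ∈-deduplicate⁺; ∈-deduplicate⁻)
open import Data.List.Properties using (≡-dec; length-++; ∷-injectiveˡ; ∷-injectiveʳ; ++-assoc; map-++; ∷-injective; reverse-++; unfold-reverse; reverse-involutive; map-∘; map-cong; ++-identityʳ; reverse-map; map-id; length-map; filter-reject; map-upTo; length-upTo)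
open import Data.List.Relation.Binary.Permutation.Propositional using (_↭_; ↭-sym; ↭-refl; swap; prep)
import Data.List.Relation.Binary.Permutation.Propositional.Properties as ↭P
open import Data.List.Relation.Unary.All as All using (All; []; _∷_)
import Data.List.Relation.Unary.All.Properties as AllP
open import Data.List.Relation.Unary.AllPairs as AllPairs using (AllPairs; []; _∷_)
import Data.List.Relation.Unary.AllPairs.Properties as APP
open import Data.List.Relation.Unary.Any as Any using (here; there; any?)
import Data.List.Relation.Unary.Any.Properties as AnyP
import Data.List.Relation.Unary.Linked as Linked
open import Data.List.Relation.Unary.Linked.Properties using (AllPairs⇒Linked; Linked⇒AllPairs)
open import Data.List.Relation.Unary.Unique.DecPropositional.Properties using (deduplicate-!)
open import Data.List.Relation.Unary.Unique.Propositional using (Unique)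
import Data.List.Relation.Unary.Unique.Propositional.Properties as UniqueP
open import Data.Nat using (ℕ; zero; suc; _+_; _≤_; _<_; _⊔_; _≟_; z≤n; s≤s; _<?_; pred; _⊓_; _∸_; _≤?_; _*_)
open import Data.Nat.ListAction using (sum)
open import Data.Nat.ListAction.Properties using (sum-++; sum-↭)
open import Data.Nat.Properties
open import Data.Product using (_×_; _,_; proj₁; proj₂; ∃; map₂)
import Data.Product.Properties as PP
open import Data.Sum using (_⊎_; inj₁; inj₂)
open import Data.Vec using (Vec; []; _∷_; lookup; toList)
open import Function using (_∘_; flip; _on_; id)
open import Level using (0ℓ)
open import Relation.Binary using (Rel; DecidableEquality)
open import Relation.Binary.Construct.Closure.ReflexiveTransitive using (Star; ε; _◅_; _◅◅_; gmap)
open import Relation.Binary.Definitions using (tri<; tri≈; tri>)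
open import Relation.Binary.PropositionalEquality using (_≡_; _≢_; refl; sym; trans; cong; cong₂; subst; module ≡-Reasoning; subst₂)
open import Relation.Nullary using (yes; no; does; ¬_; Dec; ¬?)
open import Relation.Nullary.Decidable using (dec-true; dec-false)
open import Algebra.Properties.CommutativeSemigroup +-commutativeSemigroup using (interchange; xy∙z≈xz∙y)

-- Columns of a growth diagram as bumping

-- Knuth moves are used in one direction only, from the tableau to the inserted word. This gives
-- lower bounds on the maxima and nothing more; the counting argument supplies the upper bounds, so
-- chains never have to be carried back.
--
-- The passage from units to cells is the asymmetric step. Separation sends the units of one row,
-- column or cell from top-left to bottom-right. Hence an increase between units is a strict NE step
-- between cells, and a class of increasing units meets each cell at most once. A decrease is only a
-- weak SE step, so the units of one cell may be spread over several decreasing classes, although an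
-- SE-chain must take the whole entry. Moving each such cell into a single chain can only increase
-- the total, so the SE side yields an inequality at first; the counting bound turns it into an
-- equality.
--
-- For given k the partner is l = λₖ. For given l the partner k is the last row of length at least
-- l, possibly 0.

≟ₚ-refl : ∀ ρ → (ρ ≟ₚ ρ) ≡ true
≟ₚ-refl ρ = dec-true (≡-dec _≟_ ρ ρ) refl

≟ₚ-≢ : ∀ {ρ μ} → ρ ≢ μ → (ρ ≟ₚ μ) ≡ false
≟ₚ-≢ {ρ} {μ} = dec-false (≡-dec _≟_ ρ μ)

≟-refl : ∀ n → does (n ≟ n) ≡ true
≟-refl n = dec-true (n ≟ n) refl

≟-≢ : ∀ {m n} → m ≢ n → does (m ≟ n) ≡ false
≟-≢ {m} {n} = dec-false (m ≟ n)

addSq-≢ : ∀ b ρ → ρ ≢ addSq b ρ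
addSq-≢ zero    []      ()
addSq-≢ zero    (a ∷ ρ) eq = 1+n≢n (sym (∷-injectiveˡ eq))
addSq-≢ (suc b) []      ()
addSq-≢ (suc b) (a ∷ ρ) eq = addSq-≢ b ρ (∷-injectiveʳ eq)

addSq-injective : ∀ b r ρ → addSq b ρ ≡ addSq r ρ → b ≡ r
addSq-injective zero    zero    ρ       eq = refl
addSq-injective zero    (suc r) []      ()
addSq-injective zero    (suc r) (a ∷ ρ) eq = ⊥-elim (1+n≢n (∷-injectiveˡ eq))
addSq-injective (suc b) zero    []      ()
addSq-injective (suc b) zero    (a ∷ ρ) eq = ⊥-elim (1+n≢n (sym (∷-injectiveˡ eq)))
addSq-injective (suc b) (suc r) []      eq = cong suc (addSq-injective b r [] (∷-injectiveʳ eq))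
addSq-injective (suc b) (suc r) (a ∷ ρ) eq = cong suc (addSq-injective b r ρ (∷-injectiveʳ eq))

addSq-comm : ∀ b r ρ → addSq b (addSq r ρ) ≡ addSq r (addSq b ρ)
addSq-comm zero    zero    ρ       = refl
addSq-comm zero    (suc r) []      = refl
addSq-comm zero    (suc r) (a ∷ ρ) = refl
addSq-comm (suc b) zero    []      = refl
addSq-comm (suc b) zero    (a ∷ ρ) = refl
addSq-comm (suc b) (suc r) []      = cong (0 ∷_) (addSq-comm b r [])
addSq-comm (suc b) (suc r) (a ∷ ρ) = cong (a ∷_) (addSq-comm b r ρ)

∪ₚ-identityʳ : ∀ ρ → ρ ∪ₚ [] ≡ ρ
∪ₚ-identityʳ []      = refl
∪ₚ-identityʳ (a ∷ ρ) = refl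

∪ₚ-idem : ∀ ρ → ρ ∪ₚ ρ ≡ ρ
∪ₚ-idem []      = refl
∪ₚ-idem (a ∷ ρ) = cong₂ _∷_ (⊔-idem a) (∪ₚ-idem ρ)

addSq-∪ˡ : ∀ b ρ → addSq b ρ ∪ₚ ρ ≡ addSq b ρ
addSq-∪ˡ b       []      = ∪ₚ-identityʳ (addSq b [])
addSq-∪ˡ zero    (a ∷ ρ) = cong₂ _∷_ (m≥n⇒m⊔n≡m (n≤1+n a)) (∪ₚ-idem ρ)
addSq-∪ˡ (suc b) (a ∷ ρ) = cong₂ _∷_ (⊔-idem a) (addSq-∪ˡ b ρ)

addSq-∪ʳ : ∀ b ρ → ρ ∪ₚ addSq b ρ ≡ addSq b ρ
addSq-∪ʳ b       []      = refl
addSq-∪ʳ zero    (a ∷ ρ) = cong₂ _∷_ (m≤n⇒m⊔n≡n (n≤1+n a)) (∪ₚ-idem ρ)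
addSq-∪ʳ (suc b) (a ∷ ρ) = cong₂ _∷_ (⊔-idem a) (addSq-∪ʳ b ρ)

addSq-∪ : ∀ b r ρ → b ≢ r → addSq b ρ ∪ₚ addSq r ρ ≡ addSq r (addSq b ρ)
addSq-∪ zero    zero    ρ       b≢r = ⊥-elim (b≢r refl)
addSq-∪ zero    (suc r) []      b≢r = refl
addSq-∪ zero    (suc r) (a ∷ ρ) b≢r = cong₂ _∷_ (m≥n⇒m⊔n≡m (n≤1+n a)) (addSq-∪ʳ r ρ)
addSq-∪ (suc b) zero    []      b≢r = cong (1 ∷_) (∪ₚ-identityʳ (addSq b []))
addSq-∪ (suc b) zero    (a ∷ ρ) b≢r = cong₂ _∷_ (m≤n⇒m⊔n≡n (n≤1+n a)) (addSq-∪ˡ b ρ)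
addSq-∪ (suc b) (suc r) []      b≢r = cong (0 ∷_) (addSq-∪ b r [] (b≢r ∘ cong suc))
addSq-∪ (suc b) (suc r) (a ∷ ρ) b≢r = cong₂ _∷_ (⊔-idem a) (addSq-∪ b r ρ (b≢r ∘ cong suc))

firstDiff-addSq : ∀ b ρ → firstDiff (addSq b ρ) ρ ≡ b
firstDiff-addSq zero    []      = refl
firstDiff-addSq zero    (a ∷ ρ) rewrite ≟-≢ (1+n≢n {a}) = refl
firstDiff-addSq (suc b) []      = cong suc (firstDiff-addSq b [])
firstDiff-addSq (suc b) (a ∷ ρ) rewrite ≟-refl a = cong suc (firstDiff-addSq b ρ)

-- Row indices are shifted by one, so that 0 can stand for "no square".
add : ℕ → Partition → Partition
add zero    ρ = ρ
add (suc r) ρ = addSq r ρ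

-- A vertical edge with square σ meets a horizontal edge with square b in a cell with
-- entry e: fires says whether the opposite edges both carry row suc b (rules F5, F6).
fires : (b σ e : ℕ) → Bool
fires zero    zero    zero    = false
fires zero    zero    (suc _) = true
fires zero    (suc _) _       = false
fires (suc b) σ       _       = does (σ ≟ suc b)

data FireView (b σ e : ℕ) : Bool → Set where
  hit  : σ ≡ b → (b ≡ 0 → e ≢ 0) → FireView b σ e true
  miss : (σ ≡ b → b ≡ 0) → (σ ≡ 0 → b ≡ 0 → e ≡ 0) → FireView b σ e false

fireView : ∀ b σ e → FireView b σ e (fires b σ e)
fireView zero    zero    zero    = miss (λ _ → refl) (λ _ _ → refl)
fireView zero    zero    (suc e) = hit refl (λ _ ())
fireView zero    (suc σ) e       = miss (λ ()) (λ ())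
fireView (suc b) σ       e with σ ≟ suc b
... | yes refl rewrite ≟-refl b = hit refl (λ ())
... | no σ≢    rewrite ≟-≢ σ≢   = miss (⊥-elim ∘ σ≢) (λ _ ())

bump : (b σ e : ℕ) → ℕ
bump b σ e = if fires b σ e then suc b else b

shift : (b σ e : ℕ) → ℕ
shift b σ e = if fires b σ e then suc b else σ

-- The bottom and right edges of a cell lead to the same label as its left and top edges. If the
-- cell fires, both ways add `b` and then `suc b`; otherwise two additions commute.
add-shift : ∀ ρ b σ e → add (shift b σ e) (add b ρ) ≡ add (bump b σ e) (add σ ρ)
add-shift ρ b σ e with fires b σ e | fireView b σ e
add-shift ρ b       .b      e | true  | hit refl _ = refl
add-shift ρ zero    σ       e | false | _ = refl
add-shift ρ (suc b) zero    e | false | _ = refl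
add-shift ρ (suc b) (suc σ) e | false | _ = addSq-comm σ b ρ

-- F5 and F6 are the cases in which `fires` holds. In F1 to F4 the right edge copies the square of
-- the left edge; for F4 this holds because the union of two different one-square extensions adds
-- both squares.
localRule-add : ∀ ρ b σ e → (e ≢ 0 → σ ≡ 0 × b ≡ 0) →
  localRule ρ (add b ρ) (add σ ρ) e ≡ add (shift b σ e) (add b ρ)
localRule-add ρ zero zero zero h rewrite ≟ₚ-refl ρ = refl
localRule-add ρ zero zero (suc e) h rewrite ≟ₚ-refl ρ = refl
localRule-add ρ zero (suc r) e h rewrite ≟ₚ-refl ρ | ≟ₚ-≢ (addSq-≢ r ρ) = refl
localRule-add ρ (suc b) zero e h rewrite ≟ₚ-refl ρ | ≟ₚ-≢ (addSq-≢ b ρ) = refl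
localRule-add ρ (suc b) (suc r) e h with suc r ≟ suc b
... | yes refl rewrite ≟ₚ-refl (addSq b ρ) | ≟ₚ-≢ (addSq-≢ b ρ) | firstDiff-addSq b ρ | ≟-refl b = refl
... | no r≢b rewrite ≟ₚ-≢ (addSq-≢ b ρ) | ≟ₚ-≢ (addSq-≢ r ρ)
                   | ≟ₚ-≢ (r≢b ∘ cong suc ∘ sym ∘ addSq-injective b r ρ)
                   | ≟-≢ r≢b
                   = addSq-∪ b r ρ (r≢b ∘ cong suc ∘ sym)

path : (ℕ → ℕ) → ℕ → Partition
path s zero    = []
path s (suc y) = add (s (suc y)) (path s y)

-- One column of cells: `s` lists the squares on its left vertical edges and `e` its entries. Then
-- `bumped y` is the square on the horizontal edge at height `y`, and `next` lists the squares on
-- the right vertical edges.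
module Column (s e : ℕ → ℕ) where

  bumped : ℕ → ℕ
  bumped zero    = 0
  bumped (suc y) = bump (bumped y) (s (suc y)) (e (suc y))

  next : ℕ → ℕ
  next zero    = 0
  next (suc y) = shift (bumped y) (s (suc y)) (e (suc y))

  path-next : ∀ y → path next y ≡ add (bumped y) (path s y)
  path-next zero    = refl
  path-next (suc y) = trans (cong (add (next (suc y))) (path-next y))
    (add-shift (path s y) (bumped y) (s (suc y)) (e (suc y)))

  bumped≡0 : ∀ y → (∀ y' → y' ≤ y → e y' ≡ 0) → bumped y ≡ 0
  bumped≡0 zero    h = refl
  bumped≡0 (suc y) h with bumped y | bumped≡0 y (λ y' y'≤y → h y' (m≤n⇒m≤1+n y'≤y)) | e (suc y) | h (suc y) ≤-refl
  ... | .0 | refl | .0 | refl with s (suc y)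
  ...   | zero  = refl
  ...   | suc _ = refl

  next≡0 : ∀ y → s y ≡ 0 → e y ≡ 0 → next y ≡ 0
  next≡0 zero    _  _  = refl
  next≡0 (suc y) s0 e0 rewrite s0 | e0 with bumped y
  ... | zero  = refl
  ... | suc _ = refl

-- Phrased through nonvanishing, because `localRule` only asks whether an entry is 0.
record IsPartialPermutation (g : ℕ → ℕ → ℕ) : Set where
  field
    one-per-column : ∀ {x y y'} → g x y ≢ 0 → g x y' ≢ 0 → y ≡ y'
    one-per-row    : ∀ {x x' y} → g x y ≢ 0 → g x' y ≢ 0 → x ≡ x'

module Rows (g : ℕ → ℕ → ℕ) where

  rowIn : ℕ → ℕ → ℕ
  rowIn zero    = λ _ → 0
  rowIn (suc x) = Column.next (rowIn x) (g (suc x))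

  module Col (x : ℕ) = Column (rowIn x) (g (suc x))

  rowIn≡0 : ∀ x y → (∀ x' → x' ≤ x → g x' y ≡ 0) → rowIn x y ≡ 0
  rowIn≡0 zero    y h = refl
  rowIn≡0 (suc x) y h = Col.next≡0 x y (rowIn≡0 x y (λ x' le → h x' (m≤n⇒m≤1+n le))) (h (suc x) ≤-refl)

  module _ (pp : IsPartialPermutation g) where
    open IsPartialPermutation pp

    ≢⇒zero : ∀ {n} → ¬ (n ≢ 0) → n ≡ 0
    ≢⇒zero {zero}  _ = refl
    ≢⇒zero {suc n} h = ⊥-elim (h λ ())

    -- The row of a nonzero entry is empty to its left and the column is empty below it, so no
    -- square has yet appeared on either incoming edge.
    fresh : ∀ x y → g (suc x) (suc y) ≢ 0 → rowIn x (suc y) ≡ 0 × Col.bumped x y ≡ 0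
    fresh x y g≢0 =
      rowIn≡0 x (suc y) (λ x' x'≤x → ≢⇒zero λ h → <⇒≢ (s≤s x'≤x) (one-per-row h g≢0)) ,
      Col.bumped≡0 x y (λ y' y'≤y → ≢⇒zero λ h → <⇒≢ (s≤s y'≤y) (one-per-column h g≢0))

    path≡[] : ∀ y → path (λ _ → 0) y ≡ []
    path≡[] zero    = refl
    path≡[] (suc y) = path≡[] y

    growth≡path : ∀ x y → growth g x y ≡ path (rowIn x) y
    growth≡path zero    y       = sym (path≡[] y)
    growth≡path (suc x) zero    = refl
    growth≡path (suc x) (suc y)
      rewrite growth≡path x y | growth≡path (suc x) y | growth≡path x (suc y) | Col.path-next x y
      = localRule-add (path (rowIn x) y) (Col.bumped x y) (rowIn x (suc y)) (g (suc x) (suc y)) (fresh x y)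

-- Sums over lists

∑ : ∀ {A : Set} → (A → ℕ) → List A → ℕ
∑ φ xs = sum (map φ xs)

ind : ∀ {P : Set} → Dec P → ℕ
ind P? = if does P? then 1 else 0

ind-yes : ∀ {P : Set} (P? : Dec P) → P → ind P? ≡ 1
ind-yes P? p rewrite dec-true P? p = refl

ind-no : ∀ {P : Set} (P? : Dec P) → ¬ P → ind P? ≡ 0
ind-no P? ¬p rewrite dec-false P? ¬p = refl

ind≤1 : ∀ {P : Set} (P? : Dec P) → ind P? ≤ 1
ind≤1 P? with does P?
... | true  = ≤-refl
... | false = z≤n

module _ {A : Set} where

  ∑-++ : ∀ (φ : A → ℕ) xs ys → ∑ φ (xs ++ ys) ≡ ∑ φ xs + ∑ φ ys
  ∑-++ φ xs ys = trans (cong sum (map-++ φ xs ys)) (sum-++ (map φ xs) (map φ ys))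

  ∑-↭ : ∀ (φ : A → ℕ) {xs ys} → xs ↭ ys → ∑ φ xs ≡ ∑ φ ys
  ∑-↭ φ p = sum-↭ (↭P.map⁺ φ p)

  AllPairs-++⁻ : ∀ {R : Rel A 0ℓ} xs {ys} → AllPairs R (xs ++ ys) →
                 AllPairs R xs × AllPairs R ys × All (λ x → All (R x) ys) xs
  AllPairs-++⁻ []       ps       = [] , ps , []
  AllPairs-++⁻ (x ∷ xs) (p ∷ ps) with AllPairs-++⁻ xs ps
  ... | ps₁ , ps₂ , ps₁₂ = AllP.++⁻ˡ xs p ∷ ps₁ , ps₂ , AllP.++⁻ʳ xs p ∷ ps₁₂

  AllPairs-reverse : ∀ {R : Rel A 0ℓ} {xs} → AllPairs R xs → AllPairs (flip R) (reverse xs)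
  AllPairs-reverse {xs = []}     []       = []
  AllPairs-reverse {xs = x ∷ xs} (p ∷ ps) rewrite unfold-reverse x xs =
    APP.++⁺ (AllPairs-reverse ps) ([] ∷ []) (All.map (_∷ []) (↭P.All-resp-↭ (↭-sym (↭P.↭-reverse xs)) p))

  map-split : ∀ {B : Set} (f : A → B) xs us {vs} → map f xs ≡ us ++ vs →
              ∃ λ ys → ∃ λ zs → xs ≡ ys ++ zs × map f ys ≡ us × map f zs ≡ vs
  map-split f xs       []       eq = [] , xs , refl , refl , eq
  map-split f (x ∷ xs) (u ∷ us) eq with ∷-injective eq
  ... | refl , eq' with map-split f xs us eq'
  ...   | ys , zs , refl , refl , eq'' = x ∷ ys , zs , refl , refl , eq''

-- Knuth moves and coloured words

infix 4 _↝_ _↝*_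

-- The elementary Knuth relations, oriented from a tableau towards the word that was inserted. With
-- this orientation, reversing words exchanges the two kinds of move.
data _↝_ : List ℕ → List ℕ → Set where
  yxz : ∀ {x y z} u v → x < y → y < z → u ++ y ∷ x ∷ z ∷ v ↝ u ++ y ∷ z ∷ x ∷ v
  zxy : ∀ {x y z} u v → x < y → y < z → u ++ z ∷ x ∷ y ∷ v ↝ u ++ x ∷ z ∷ y ∷ v

_↝*_ : List ℕ → List ℕ → Set
_↝*_ = Star _↝_

↝-∷ : ∀ a {w w'} → w ↝ w' → a ∷ w ↝ a ∷ w'
↝-∷ a (yxz u v p q) = yxz (a ∷ u) v p q
↝-∷ a (zxy u v p q) = zxy (a ∷ u) v p q

↝*-++ˡ : ∀ u {w w'} → w ↝* w' → u ++ w ↝* u ++ w'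
↝*-++ˡ []      ps = ps
↝*-++ˡ (a ∷ u) ps = gmap (a ∷_) (↝-∷ a) (↝*-++ˡ u ps)

↝-++ʳ : ∀ t {w w'} → w ↝ w' → w ++ t ↝ w' ++ t
↝-++ʳ t (yxz u v p q) = subst₂ _↝_ (sym (++-assoc u _ t)) (sym (++-assoc u _ t)) (yxz u (v ++ t) p q)
↝-++ʳ t (zxy u v p q) = subst₂ _↝_ (sym (++-assoc u _ t)) (sym (++-assoc u _ t)) (zxy u (v ++ t) p q)

↝*-++ʳ : ∀ t {w w'} → w ↝* w' → w ++ t ↝* w' ++ t
↝*-++ʳ t = gmap (_++ t) (↝-++ʳ t)

reverse-triple : ∀ u (a b c : ℕ) v → reverse (u ++ a ∷ b ∷ c ∷ v) ≡ reverse v ++ c ∷ b ∷ a ∷ reverse u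
reverse-triple u a b c v = begin
  reverse (u ++ a ∷ b ∷ c ∷ v)                ≡⟨ reverse-++ u _ ⟩
  reverse ((a ∷ b ∷ c ∷ []) ++ v) ++ reverse u ≡⟨ cong (_++ reverse u) (reverse-++ (a ∷ b ∷ c ∷ []) v) ⟩
  (reverse v ++ c ∷ b ∷ a ∷ []) ++ reverse u   ≡⟨ ++-assoc (reverse v) _ _ ⟩
  reverse v ++ c ∷ b ∷ a ∷ reverse u           ∎
  where open ≡-Reasoning

↝-reverse : ∀ {w w'} → w ↝ w' → reverse w ↝ reverse w'
↝-reverse (yxz u v p q) =
  subst₂ _↝_ (sym (reverse-triple u _ _ _ v)) (sym (reverse-triple u _ _ _ v)) (zxy (reverse v) (reverse u) p q)
↝-reverse (zxy u v p q) =
  subst₂ _↝_ (sym (reverse-triple u _ _ _ v)) (sym (reverse-triple u _ _ _ v)) (yxz (reverse v) (reverse u) p q)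

length-↝ : ∀ {w w'} → w ↝ w' → length w ≡ length w'
length-↝ (yxz u v p q) = trans (length-++ u) (sym (length-++ u))
length-↝ (zxy u v p q) = trans (length-++ u) (sym (length-++ u))

length-↝* : ∀ {w w'} → w ↝* w' → length w ≡ length w'
length-↝* ε        = refl
length-↝* (p ◅ ps) = trans (length-↝ p) (length-↝* ps)

Compatible : Rel ℕ 0ℓ → ℕ → Rel (ℕ × ℕ) 0ℓ
Compatible _~_ k (v , c) (v' , c') = c ≡ c' → c < k → v ~ v'

active : ∀ {A : Set} → ℕ → List (A × ℕ) → ℕ
active k = ∑ (λ p → ind (proj₂ p <? k))

-- The letters of colour c < k form the c-th of k disjoint chains; the other letters
-- are in no chain.
Colouring : Rel ℕ 0ℓ → ℕ → ℕ → List ℕ → Set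
Colouring _~_ k n w = ∃ λ cs → map proj₁ cs ≡ w × AllPairs (Compatible _~_ k) cs × active k cs ≡ n

Colouring-reverse : ∀ {_~_ k n w} → Colouring _~_ k n w → Colouring (flip _~_) k n (reverse w)
Colouring-reverse {k = k} (cs , refl , ps , refl) =
  reverse cs , reverse-map proj₁ cs ,
  AllPairs.map (λ r c≡c' c<k → r (sym c≡c') (subst (_< k) c≡c' c<k)) (AllPairs-reverse ps) ,
  ∑-↭ _ (↭P.↭-reverse cs)

swapColour : ℕ → ℕ → ℕ → ℕ
swapColour c d e with e ≟ c | e ≟ d
... | yes _ | _     = d
... | no _  | yes _ = c
... | no _  | no _  = e

data SwapView (c d e : ℕ) : ℕ → Set where
  left  : e ≡ c → SwapView c d e d
  right : e ≡ d → SwapView c d e c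
  other : e ≢ c → e ≢ d → SwapView c d e e

swapView : ∀ c d e → SwapView c d e (swapColour c d e)
swapView c d e with e ≟ c | e ≟ d
... | yes p | _     = left p
... | no _  | yes p = right p
... | no p  | no q  = other p q

ind-swap : ∀ {c d k} → c < k → d < k → ∀ e → ind (swapColour c d e <? k) ≡ ind (e <? k)
ind-swap {c} {d} {k} c<k d<k e with swapColour c d e | swapView c d e
... | _ | left refl  = trans (ind-yes (d <? k) d<k) (sym (ind-yes (c <? k) c<k))
... | _ | right refl = trans (ind-yes (c <? k) c<k) (sym (ind-yes (d <? k) d<k))
... | _ | other _ _  = refl

active-recolour : ∀ {A : Set} k (f : ℕ → ℕ) → (∀ e → ind (f e <? k) ≡ ind (e <? k)) →
                  ∀ (cs : List (A × ℕ)) → active k (map (map₂ f) cs) ≡ active k cs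
active-recolour k f h cs = cong sum (trans (sym (map-∘ cs)) (map-cong (h ∘ proj₂) cs))

map-proj₁-recolour : ∀ {A : Set} (f : ℕ → ℕ) (cs : List (A × ℕ)) → map proj₁ (map (map₂ f) cs) ≡ map proj₁ cs
map-proj₁-recolour f cs = sym (map-∘ cs)

module _ {k : ℕ} where

  private
    _≺_ : Rel (ℕ × ℕ) 0ℓ
    _≺_ = Compatible _<_ k

  ≺-swap : ∀ {c d p q} → c < k → d < k → p ≺ q → map₂ (swapColour c d) p ≺ map₂ (swapColour c d) q
  ≺-swap {c} {d} {v , e} {v' , e'} c<k d<k r eq lt
    with swapColour c d e | swapView c d e | swapColour c d e' | swapView c d e'
  ... | _ | left refl  | _ | left refl  = r refl c<k
  ... | _ | left refl  | _ | right refl = r (sym eq) c<k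
  ... | _ | left refl  | _ | other _ n  = ⊥-elim (n (sym eq))
  ... | _ | right refl | _ | left refl  = r (sym eq) d<k
  ... | _ | right refl | _ | right refl = r refl d<k
  ... | _ | right refl | _ | other n _  = ⊥-elim (n (sym eq))
  ... | _ | other _ n  | _ | left refl  = ⊥-elim (n eq)
  ... | _ | other n _  | _ | right refl = ⊥-elim (n eq)
  ... | _ | other _ _  | _ | other _ _  = r eq lt

  AllPairs-transpose : ∀ cu {p q cv} → q ≺ p → AllPairs _≺_ (cu ++ p ∷ q ∷ cv) → AllPairs _≺_ (cu ++ q ∷ p ∷ cv)
  AllPairs-transpose cu q≺p ps with AllPairs-++⁻ cu ps
  ... | us , (_ ∷ ps₁) ∷ qs ∷ vs , uvs =
    APP.++⁺ us ((q≺p ∷ qs) ∷ ps₁ ∷ vs) (All.map (λ { (a ∷ b ∷ cs) → b ∷ a ∷ cs }) uvs)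

  active-transpose : ∀ cu (p q : ℕ × ℕ) cv → active k (cu ++ q ∷ p ∷ cv) ≡ active k (cu ++ p ∷ q ∷ cv)
  active-transpose cu p q cv = ∑-↭ _ (↭P.++⁺ˡ cu (swap q p ↭-refl))

  -- The colour c of x and z has to be broken up after the move.  If y is in a chain, the
  -- chains of x and y exchange their tails; otherwise y replaces x.
  resolve-conflict : ∀ {x y z c d} cu cv → x < y → y < z → c < k →
    AllPairs _≺_ (cu ++ (y , d) ∷ (x , c) ∷ (z , c) ∷ cv) →
    Colouring _<_ k (active k (cu ++ (y , d) ∷ (x , c) ∷ (z , c) ∷ cv)) (map proj₁ cu ++ y ∷ z ∷ x ∷ map proj₁ cv)
  resolve-conflict {x} {y} {z} {c} {d} cu cv x<y y<z c<k ps with AllPairs-++⁻ cu ps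
  ... | us , (y≺x ∷ y≺z ∷ yv) ∷ (x≺z ∷ xv) ∷ zv ∷ vs , uvs = cases
    where
    d≢c : d ≢ c
    d≢c refl = <-asym x<y (y≺x refl c<k)

    χ : ℕ → ℕ
    χ e = ind (e <? k)

    cases : Colouring _<_ k (active k (cu ++ (y , d) ∷ (x , c) ∷ (z , c) ∷ cv)) (map proj₁ cu ++ y ∷ z ∷ x ∷ map proj₁ cv)
    cases with d <? k
    ... | no d≮k =
      cu ++ (y , c) ∷ (z , c) ∷ (x , d) ∷ cv ,
      map-++ proj₁ cu _ ,
      APP.++⁺ us
        (((λ _ _ → y<z) ∷ (λ eq _ → ⊥-elim (d≢c (sym eq))) ∷ All.map (λ r eq lt → <-trans y<z (r eq lt)) zv)
         ∷ ((λ eq _ → ⊥-elim (d≢c (sym eq))) ∷ zv)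
         ∷ All.universal (λ _ _ d<k → ⊥-elim (d≮k d<k)) cv
         ∷ vs)
        (All.map (λ { (ry ∷ rx ∷ rz ∷ rv) → (λ eq lt → <-trans (rx eq lt) x<y) ∷ rz
                      ∷ (λ eq lt → ⊥-elim (d≮k (subst (_< k) eq lt))) ∷ rv }) uvs) ,
      trans (∑-++ _ cu _) (trans (cong (active k cu +_) count) (sym (∑-++ _ cu _)))
      where
      count : χ c + (χ c + (χ d + active k cv)) ≡ χ d + (χ c + (χ c + active k cv))
      count rewrite ind-no (d <? k) d≮k = refl
    ... | yes d<k =
      cu ++ (y , d) ∷ (z , d) ∷ (x , c) ∷ map τ cv ,
      trans (map-++ proj₁ cu _) (cong (λ h → map proj₁ cu ++ y ∷ z ∷ x ∷ h) (map-proj₁-recolour (swapColour c d) cv)) ,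
      APP.++⁺ us
        (((λ _ _ → y<z) ∷ (λ eq _ → ⊥-elim (d≢c eq)) ∷ AllP.map⁺ (All.map (λ r eq lt → <-trans y<z (r eq lt)) zτ))
         ∷ ((λ eq _ → ⊥-elim (d≢c eq)) ∷ AllP.map⁺ zτ)
         ∷ AllP.map⁺ (All.map xτ yv)
         ∷ APP.map⁺ (AllPairs.map (≺-swap c<k d<k) vs))
        (All.map (λ { (ry ∷ rx ∷ rz ∷ rv) → ry ∷ (λ eq lt → <-trans (ry eq lt) y<z) ∷ rx
                      ∷ AllP.map⁺ (All.zipWith (λ (r , yr , zr) → uτ ry rx r yr zr) (rv , All.zip (yv , zv))) }) uvs) ,
      trans (∑-++ _ cu _) (trans (cong (active k cu +_) count) (sym (∑-++ _ cu _)))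
      where
      τ : ℕ × ℕ → ℕ × ℕ
      τ = map₂ (swapColour c d)

      zτ : All (λ q → (z , d) ≺ τ q) cv
      zτ = All.map aux zv
        where
        aux : ∀ {q} → (z , c) ≺ q → (z , d) ≺ τ q
        aux {_ , e} r eq lt with swapColour c d e | swapView c d e
        ... | _ | left refl  = r refl c<k
        ... | _ | right _    = ⊥-elim (d≢c eq)
        ... | _ | other _ n  = ⊥-elim (n (sym eq))

      xτ : ∀ {q} → (y , d) ≺ q → (x , c) ≺ τ q
      xτ {_ , e} r eq lt with swapColour c d e | swapView c d e
      ... | _ | left _     = ⊥-elim (d≢c (sym eq))
      ... | _ | right refl = <-trans x<y (r refl d<k)
      ... | _ | other n _  = ⊥-elim (n (sym eq))

      -- After the exchange a letter before the block shares its colour with a tail it was not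
      -- compared with. The block bridges the gap: `p < y < z < q` if the tail letter had colour
      -- `c`, and `p < x < y < q` if it had colour `d`.
      uτ : ∀ {p q} → p ≺ (y , d) → p ≺ (x , c) → p ≺ q → (y , d) ≺ q → (z , c) ≺ q → p ≺ τ q
      uτ {_} {_ , e} py px pq yq zq eq lt with swapColour c d e | swapView c d e
      ... | _ | left refl  = <-trans (py eq lt) (<-trans y<z (zq refl c<k))
      ... | _ | right refl = <-trans (px eq lt) (<-trans x<y (yq refl d<k))
      ... | _ | other _ _  = pq eq lt

      count : χ d + (χ d + (χ c + active k (map τ cv))) ≡ χ d + (χ c + (χ c + active k cv))
      count = cong₂ (λ a b → χ d + (a + (χ c + b)))
        (trans (ind-yes (d <? k) d<k) (sym (ind-yes (c <? k) c<k)))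
        (active-recolour k (swapColour c d) (ind-swap c<k d<k) cv)

  transpose-second : ∀ {x y z c c' d} cu cv → (z , c') ≺ (x , c) →
    AllPairs _≺_ (cu ++ (y , d) ∷ (x , c) ∷ (z , c') ∷ cv) →
    Colouring _<_ k (active k (cu ++ (y , d) ∷ (x , c) ∷ (z , c') ∷ cv)) (map proj₁ cu ++ y ∷ z ∷ x ∷ map proj₁ cv)
  transpose-second {x} {y} {z} {c} {c'} {d} cu cv z≺x ps =
    cu ++ (y , d) ∷ (z , c') ∷ (x , c) ∷ cv , map-++ proj₁ cu _ ,
    subst (AllPairs _≺_) (++-assoc cu [ y , d ] _)
      (AllPairs-transpose (cu ++ [ y , d ]) z≺x (subst (AllPairs _≺_) (sym (++-assoc cu [ y , d ] _)) ps)) ,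
    ∑-↭ _ (↭P.++⁺ˡ cu (prep _ (swap _ _ ↭-refl)))

  -- A move transposes two adjacent letters. In `zxy` the pair becomes ascending, which suits any
  -- colouring. In `yxz` it becomes descending, which does harm only if both letters share a colour
  -- below `k`.
  Colouring-<-↝ : ∀ {n w w'} → w ↝ w' → Colouring _<_ k n w → Colouring _<_ k n w'
  Colouring-<-↝ (yxz u v x<y y<z) (cs , eq , ps , refl) with map-split proj₁ cs u eq
  ... | cu , (_ , d) ∷ (_ , c) ∷ (_ , c') ∷ cv , refl , refl , refl with c ≟ c' | c <? k
  ...   | yes refl | yes c<k = resolve-conflict cu cv x<y y<z c<k ps
  ...   | no c≢c'  | _       = transpose-second cu cv (λ eq _ → ⊥-elim (c≢c' (sym eq))) ps
  ...   | yes refl | no c≮k  = transpose-second cu cv (λ _ c<k → ⊥-elim (c≮k c<k)) ps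
  Colouring-<-↝ (zxy u v x<y y<z) (cs , eq , ps , refl) with map-split proj₁ cs u eq
  ... | cu , p@(_ , _) ∷ q@(_ , _) ∷ r@(_ , _) ∷ cv , refl , refl , refl =
    cu ++ q ∷ p ∷ r ∷ cv , map-++ proj₁ cu _ ,
    AllPairs-transpose cu (λ _ _ → <-trans x<y y<z) ps ,
    active-transpose cu p q (r ∷ cv)

  -- Reversal turns decreasing chains into increasing ones and moves into moves.
  Colouring->-↝ : ∀ {n w w'} → w ↝ w' → Colouring (flip _<_) k n w → Colouring (flip _<_) k n w'
  Colouring->-↝ {n} {w} {w'} p col =
    subst (Colouring (flip _<_) k n) (reverse-involutive w')
      (Colouring-reverse (Colouring-<-↝ (↝-reverse p) (Colouring-reverse col)))

  Colouring-<-↝* : ∀ {n w w'} → w ↝* w' → Colouring _<_ k n w → Colouring _<_ k n w'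
  Colouring-<-↝* ε        col = col
  Colouring-<-↝* (p ◅ ps) col = Colouring-<-↝* ps (Colouring-<-↝ p col)

  Colouring->-↝* : ∀ {n w w'} → w ↝* w' → Colouring (flip _<_) k n w → Colouring (flip _<_) k n w'
  Colouring->-↝* ε        col = col
  Colouring->-↝* (p ◅ ps) col = Colouring->-↝* ps (Colouring->-↝ p col)

-- Bumping as a sequence of Knuth moves

extend : ∀ {A : Set} → ℕ → ℕ → A → List A → List A
extend σ i a as = if does (σ ≟ i) then as ++ [ a ] else as

extend-≡ : ∀ {A : Set} i (a : A) as → extend i i a as ≡ as ++ [ a ]
extend-≡ i a as rewrite ≟-refl i = refl

extend-≢ : ∀ {A : Set} {σ i} (a : A) as → σ ≢ i → extend σ i a as ≡ as
extend-≢ a as σ≢i rewrite ≟-≢ σ≢i = refl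

-- Row `i` of the insertion tableau: the heights at which the vertical line with squares `s` gains a
-- square in row `i`.
row : (ℕ → ℕ) → ℕ → ℕ → List ℕ
row s i zero    = []
row s i (suc y) = extend (s (suc y)) i (suc y) (row s i y)

row-bounded : ∀ s i y → All (_≤ y) (row s i y)
row-bounded s i zero    = []
row-bounded s i (suc y) with s (suc y) ≟ i
... | yes refl rewrite extend-≡ (s (suc y)) (suc y) (row s (s (suc y)) y) =
  AllP.++⁺ (All.map m≤n⇒m≤1+n (row-bounded s _ y)) (≤-refl ∷ [])
... | no σ≢i rewrite extend-≢ (suc y) (row s i y) σ≢i = All.map m≤n⇒m≤1+n (row-bounded s i y)

row-sorted : ∀ s i y → AllPairs _<_ (row s i y)
row-sorted s i zero    = []
row-sorted s i (suc y) with s (suc y) ≟ i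
... | yes refl rewrite extend-≡ (s (suc y)) (suc y) (row s (s (suc y)) y) =
  APP.++⁺ (row-sorted s _ y) ([] ∷ []) (All.map (λ v≤y → s≤s v≤y ∷ []) (row-bounded s _ y))
... | no σ≢i rewrite extend-≢ (suc y) (row s i y) σ≢i = row-sorted s i y

length-row-≡ : ∀ s i y → s (suc y) ≡ i → length (row s i (suc y)) ≡ suc (length (row s i y))
length-row-≡ s i y refl rewrite extend-≡ (s (suc y)) (suc y) (row s (s (suc y)) y) =
  trans (length-++ (row s _ y)) (+-comm _ 1)

length-row-≢ : ∀ s i y → s (suc y) ≢ i → length (row s i (suc y)) ≡ length (row s i y)
length-row-≢ s i y σ≢i = cong length (extend-≢ (suc y) (row s i y) σ≢i)

length-row-step : ∀ s i y → length (row s i y) ≤ length (row s i (suc y))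
length-row-step s i y with s (suc y) ≟ i
... | yes σ≡i = ≤-trans (n≤1+n _) (≤-reflexive (sym (length-row-≡ s i y σ≡i)))
... | no  σ≢i = ≤-reflexive (sym (length-row-≢ s i y σ≢i))

length-row-mono : ∀ s i {y y'} → y ≤ y' → length (row s i y) ≤ length (row s i y')
length-row-mono s i {y} {zero}   z≤n = ≤-refl
length-row-mono s i {y} {suc y'} y≤  with m≤n⇒m<n∨m≡n y≤
... | inj₁ (s≤s y≤y') = ≤-trans (length-row-mono s i y≤y') (length-row-step s i y')
... | inj₂ refl       = ≤-refl

reading : (ℕ → ℕ) → ℕ → ℕ → List ℕ
reading s zero    y = []
reading s (suc i) y = row s (suc i) y ++ reading s i y

-- A firing at height `v` is a bump: the value `v` leaves row `b` (or, for `b` equal to 0, is newly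
-- inserted) and enters row `suc b`.
enter : (b σ e i v : ℕ) → List ℕ → List ℕ
enter b σ e i v zs = if fires b σ e then (if does (suc b ≟ i) then [ v ] else zs) else zs

-- Row i before (as) and after (as') the values up to y have been processed, where b is the
-- row of the square by which the new column is ahead; zs holds the value inserted into
-- row i, and zs' the value bumped from row i into row suc i.
data RowState (i y b : ℕ) (as as' zs zs' : List ℕ) : Set where
  before : b < i → as' ≡ as → zs ≡ [] → zs' ≡ [] → RowState i y b as as' zs zs'
  at     : ∀ z → b ≡ i → z ≤ y → as' ≡ as ++ [ z ] → zs ≡ [ z ] → zs' ≡ [] → RowState i y b as as' zs zs'
  after  : ∀ us z z' vs → i < b → z < z' → as ≡ us ++ z' ∷ vs → as' ≡ us ++ z ∷ vs →
           zs ≡ [ z ] → zs' ≡ [ z' ] → RowState i y b as as' zs zs'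

-- As the height grows, the horizontal edge only climbs, so a row passes from `before` through `at`
-- to `after`. While the state is `at`, the inserted `z` ends the new row; the next value of the old
-- row then makes the cell fire, which is exactly that value being bumped by `z`.
rowState-step : ∀ {i y b as as' zs zs'} σ e → RowState (suc i) y b as as' zs zs' →
  RowState (suc i) (suc y) (bump b σ e) (extend σ (suc i) (suc y) as) (extend (shift b σ e) (suc i) (suc y) as')
           (enter b σ e (suc i) (suc y) zs) (enter b σ e (suc (suc i)) (suc y) zs')
rowState-step {i} {y} {b} {as} {as'} {zs} {zs'} σ e st with fires b σ e | fireView b σ e | st
... | true | hit refl _ | before b<i refl refl refl with suc b ≟ suc i
...   | yes refl rewrite ≟-refl b | ≟-≢ (1+n≢n {b} ∘ sym) = at (suc y) refl ≤-refl refl refl refl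
...   | no b≢i rewrite ≟-≢ (<⇒≢ b<i) | ≟-≢ (b≢i ∘ cong suc) =
  before (≤∧≢⇒< b<i b≢i) refl refl refl
rowState-step {i} {y} {b} {as} {as'} {zs} {zs'} σ e st | true | hit refl _ | at z refl z≤y refl refl refl
  rewrite ≟-refl i | ≟-≢ (1+n≢n {i}) = after as z (suc y) [] ≤-refl (s≤s z≤y) refl refl refl refl
rowState-step {i} {y} {b} {as} {as'} {zs} {zs'} σ e st | true | hit refl _ | after us z z' vs i<b z<z' refl refl refl refl
  rewrite ≟-≢ (<⇒≢ i<b ∘ sym) | ≟-≢ {b} {i} (λ { refl → 1+n≰n (<⇒≤ i<b) }) =
  after us z z' vs (m≤n⇒m≤1+n i<b) z<z' refl refl refl refl
rowState-step {i} {y} {b} {as} {as'} {zs} {zs'} σ e st | false | miss _ _ | before b<i refl refl refl =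
  before b<i refl refl refl
rowState-step {i} {y} {b} {as} {as'} {zs} {zs'} σ e st | false | miss σ≡b⇒ _ | at z refl z≤y refl refl refl
  rewrite ≟-≢ {σ} {suc i} (1+n≢0 ∘ σ≡b⇒) = at z refl (m≤n⇒m≤1+n z≤y) refl refl refl
rowState-step {i} {y} {b} {as} {as'} {zs} {zs'} σ e st | false | miss _ _ | after us z z' vs i<b z<z' refl refl refl refl
  with does (σ ≟ suc i)
... | true  = after us z z' (vs ++ [ suc y ]) i<b z<z' (++-assoc us _ _) (++-assoc us _ _) refl refl
... | false = after us z z' vs i<b z<z' refl refl refl refl

-- The bumped value travels right past smaller letters. Each `zxy` move needs a middle letter, which
-- is the next letter of the row; for the last letter of `us` it is `z`.
move-out : ∀ us {z z'} vs → AllPairs _<_ (us ++ z ∷ vs) → All (_< z') us → z < z' →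
           z' ∷ us ++ z ∷ vs ↝* us ++ z' ∷ z ∷ vs
move-out []           vs _                   _          _    = ε
move-out (u ∷ [])     vs ((u<z ∷ _) ∷ _)     _          z<z' = zxy [] _ u<z z<z' ◅ ε
move-out (u ∷ v ∷ us) vs ((u<v ∷ _) ∷ ps) (_ ∷ v<z' ∷ us<z') z<z' =
  zxy [] _ u<v v<z' ◅ ↝*-++ˡ [ u ] (move-out (v ∷ us) vs ps (v<z' ∷ us<z') z<z')

-- The inserted value travels to the end of the row; the middle letter of each `yxz` move is the one
-- immediately to its left.
move-in : ∀ {z z'} vs → z < z' → AllPairs _<_ (z' ∷ vs) → z' ∷ z ∷ vs ↝* z' ∷ vs ++ [ z ]
move-in []       z<z' _ = ε
move-in {z' = z'} (v ∷ vs) z<z' ((z'<v ∷ _) ∷ ps) =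
  yxz [] vs z<z' z'<v ◅ ↝*-++ˡ [ z' ] (move-in vs (<-trans z<z' z'<v) ps)

rowState-↝* : ∀ {i y b as as' zs zs'} → AllPairs _<_ as → AllPairs _<_ as' →
              RowState i y b as as' zs zs' → zs' ++ as' ↝* as ++ zs
rowState-↝* {as = as} _ _ (before _ refl refl refl)     = subst (as ↝*_) (sym (++-identityʳ as)) ε
rowState-↝* _ _ (at z _ _ refl refl refl)   = ε
rowState-↝* ps ps' (after us z z' vs _ z<z' refl refl refl refl) with AllPairs-++⁻ us ps
... | _ , qs , us<z' =
  subst (z' ∷ us ++ z ∷ vs ↝*_) (sym (++-assoc us (z' ∷ vs) [ z ]))
    (move-out us vs ps' (All.map All.head us<z') z<z' ◅◅ ↝*-++ˡ us (move-in vs z<z' qs))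

-- The Yamanouchi condition: at every height the row lengths reached so far form a partition.
IsLattice : (ℕ → ℕ) → Set
IsLattice s = ∀ y i → length (row s (suc (suc i)) y) ≤ length (row s (suc i) y)

module Insertion (s e : ℕ → ℕ) where

  open Column s e

  entering : ℕ → ℕ → List ℕ
  entering i zero    = []
  entering i (suc y) = enter (bumped y) (s (suc y)) (e (suc y)) i (suc y) (entering i y)

  rowState : ∀ i y → RowState (suc i) y (bumped y) (row s (suc i) y) (row next (suc i) y)
                              (entering (suc i) y) (entering (suc (suc i)) y)
  rowState i zero    = before (s≤s z≤n) refl refl refl
  rowState i (suc y) = rowState-step (s (suc y)) (e (suc y)) (rowState i y)

  -- The row-by-row statement `rowState-↝*` telescopes: what is bumped out of one row is what enters
  -- the row above it. Only the values at the two ends, above row `n` and into row 1, remain.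
  reading-next : ∀ n y → entering (suc n) y ++ reading next n y ↝* reading s n y ++ entering 1 y
  reading-next zero    y = subst (_↝* entering 1 y) (sym (++-identityʳ (entering 1 y))) ε
  reading-next (suc n) y = subst₂ _↝*_
    (++-assoc (entering (suc (suc n)) y) _ _) (sym (++-assoc (row s (suc n) y) _ _))
    (↝*-++ʳ (reading next n y) (rowState-↝* (row-sorted s (suc n) y) (row-sorted next (suc n) y) (rowState n y))
     ◅◅ subst (_↝* row s (suc n) y ++ reading s n y ++ entering 1 y)
              (sym (++-assoc (row s (suc n) y) (entering (suc n) y) _))
              (↝*-++ˡ (row s (suc n) y) (reading-next n y)))

  entering≡[] : ∀ n y → bumped y ≤ n → entering (suc n) y ≡ []
  entering≡[] n y b≤n with rowState n y
  ... | before _ _ zs≡[] _            = zs≡[]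
  ... | at _ b≡1+n _ _ _ _            = ⊥-elim (<⇒≢ (s≤s b≤n) b≡1+n)
  ... | after _ _ _ _ n<b _ _ _ _ _   = ⊥-elim (<⇒≱ n<b (m≤n⇒m≤1+n b≤n))

  module _ {n : ℕ} (s≤n : ∀ y → s y ≤ n) where

    bumped≤ : ∀ y → bumped y ≤ suc n
    bumped≤ zero    = z≤n
    bumped≤ (suc y) with fires (bumped y) (s (suc y)) (e (suc y)) | fireView (bumped y) (s (suc y)) (e (suc y))
    ... | true  | hit σ≡b _ = s≤s (subst (_≤ n) σ≡b (s≤n (suc y)))
    ... | false | _         = bumped≤ y

    next≤ : ∀ y → next y ≤ suc n
    next≤ zero    = z≤n
    next≤ (suc y) with fires (bumped y) (s (suc y)) (e (suc y)) | fireView (bumped y) (s (suc y)) (e (suc y))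
    ... | true  | hit σ≡b _ = s≤s (subst (_≤ n) σ≡b (s≤n (suc y)))
    ... | false | _         = m≤n⇒m≤1+n (s≤n (suc y))

  entering⁻ : ∀ y {v} → v ∈ entering 1 y → 1 ≤ v × v ≤ y × e v ≢ 0
  entering⁻ (suc y) {v} v∈ with bumped y | fires (bumped y) (s (suc y)) (e (suc y)) | fireView (bumped y) (s (suc y)) (e (suc y))
  entering⁻ (suc y) (here refl) | zero | true | hit _ e≢0 = s≤s z≤n , ≤-refl , e≢0 refl
  entering⁻ (suc y) v∈ | suc _ | true  | _ with entering⁻ y v∈
  ... | 1≤v , v≤y , e≢0 = 1≤v , m≤n⇒m≤1+n v≤y , e≢0
  entering⁻ (suc y) v∈ | _     | false | _ with entering⁻ y v∈
  ... | 1≤v , v≤y , e≢0 = 1≤v , m≤n⇒m≤1+n v≤y , e≢0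

  -- The second conclusion strengthens the induction: once the horizontal edge carries a square it
  -- never becomes flat again, so no later firing replaces the value that entered row 1.
  entering⁺ : ∀ {v} y → suc v ≤ y → s (suc v) ≡ 0 → bumped v ≡ 0 → e (suc v) ≢ 0 →
              suc v ∈ entering 1 y × 1 ≤ bumped y
  entering⁺ {v} (suc y) v<y s0 b0 e≢0 with m≤n⇒m<n∨m≡n v<y
  ... | inj₂ refl with bumped v | b0 | s (suc v) | s0 | e (suc v)
  ...   | .0 | refl | .0 | refl | zero  = ⊥-elim (e≢0 refl)
  ...   | .0 | refl | .0 | refl | suc _ = here refl , ≤-refl
  entering⁺ {v} (suc y) v<y s0 b0 e≢0 | inj₁ (s≤s v<y') with entering⁺ y v<y' s0 b0 e≢0
  ... | v∈ , 1≤b with bumped y | 1≤b | fires (bumped y) (s (suc y)) (e (suc y))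
  ...   | suc b | _ | true  = v∈ , s≤s z≤n
  ...   | suc b | _ | false = v∈ , s≤s z≤n

  module _ (lattice : IsLattice s) where

    -- When the edge rose to row `suc (suc i)`, the old line had just gained a square in the row
    -- below. Until it rises again, no square of the old line lands in its own row, since that would
    -- make the cell fire. This leaves room for the extra square in `next-lattice`.
    bumped-strict : ∀ y i → bumped y ≡ suc (suc i) → length (row s (suc (suc i)) y) < length (row s (suc i) y)
    bumped-strict (suc y) i b≡ with fires (bumped y) (s (suc y)) (e (suc y)) | fireView (bumped y) (s (suc y)) (e (suc y))
    ... | true  | hit σ≡b _  = subst₂ _<_
      (sym (length-row-≢ s (suc (suc i)) y (λ σ≡ → 1+n≢n (trans (sym σ≡) σ≡1+i))))
      (sym (length-row-≡ s (suc i) y σ≡1+i)) (s≤s (lattice y i))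
      where
      σ≡1+i : s (suc y) ≡ suc i
      σ≡1+i = trans σ≡b (suc-injective b≡)
    ... | false | miss σ≡b⇒ _ = ≤-trans
      (≤-reflexive (cong suc (length-row-≢ s (suc (suc i)) y (λ σ≡ → 1+n≢0 (trans (sym b≡) (σ≡b⇒ (trans σ≡ (sym b≡))))))))
      (≤-trans (bumped-strict y i b≡) (length-row-step s (suc i) y))

    next-lattice : IsLattice next
    next-lattice y i = upper (rowState (suc i) y)
      where
      grows : length (row s (suc i) y) ≤ length (row next (suc i) y)
      grows with rowState i y
      ... | before _ eq _ _             = ≤-reflexive (cong length (sym eq))
      ... | at z _ _ eq _ _             = ≤-trans (m≤m+n _ 1) (≤-reflexive (sym (trans (cong length eq) (length-++ (row s (suc i) y)))))
      ... | after us z z' vs _ _ eq eq' _ _ =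
        ≤-reflexive (trans (cong length eq) (trans (length-++ us) (sym (trans (cong length eq') (length-++ us)))))

      upper : ∀ {zs zs'} → RowState (suc (suc i)) y (bumped y) (row s (suc (suc i)) y) (row next (suc (suc i)) y) zs zs' →
              length (row next (suc (suc i)) y) ≤ length (row next (suc i) y)
      upper (before _ eq _ _) = ≤-trans (≤-reflexive (cong length eq)) (≤-trans (lattice y i) grows)
      upper (at z b≡ _ eq _ _) = ≤-trans
        (≤-reflexive (trans (cong length eq) (trans (length-++ (row s (suc (suc i)) y)) (+-comm _ 1))))
        (≤-trans (bumped-strict y i b≡) grows)
      upper (after us z z' vs _ _ eq eq' _ _) = ≤-trans
        (≤-reflexive (trans (cong length eq') (trans (length-++ us) (sym (trans (cong length eq) (length-++ us))))))
        (≤-trans (lattice y i) grows)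

-- Colourings of tableaux

-- For a partition, `heightAt` looks up a part, with the value 0 beyond the last one.
heightAt-addSq-≡ : ∀ r ρ → heightAt (addSq r ρ) (suc r) ≡ suc (heightAt ρ (suc r))
heightAt-addSq-≡ zero    []      = refl
heightAt-addSq-≡ zero    (a ∷ ρ) = refl
heightAt-addSq-≡ (suc r) []      = heightAt-addSq-≡ r []
heightAt-addSq-≡ (suc r) (a ∷ ρ) = heightAt-addSq-≡ r ρ

heightAt-addSq-≢ : ∀ r ρ i → r ≢ i → heightAt (addSq r ρ) (suc i) ≡ heightAt ρ (suc i)
heightAt-addSq-≢ zero    ρ       zero    r≢i = ⊥-elim (r≢i refl)
heightAt-addSq-≢ zero    []      (suc i) r≢i = refl
heightAt-addSq-≢ zero    (a ∷ ρ) (suc i) r≢i = refl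
heightAt-addSq-≢ (suc r) []      zero    r≢i = refl
heightAt-addSq-≢ (suc r) (a ∷ ρ) zero    r≢i = refl
heightAt-addSq-≢ (suc r) []      (suc i) r≢i = heightAt-addSq-≢ r [] i (r≢i ∘ cong suc)
heightAt-addSq-≢ (suc r) (a ∷ ρ) (suc i) r≢i = heightAt-addSq-≢ r ρ i (r≢i ∘ cong suc)

heightAt-path : ∀ s y i → heightAt (path s y) (suc i) ≡ length (row s (suc i) y)
heightAt-path s zero    i = refl
heightAt-path s (suc y) i with s (suc y) ≟ suc i
... | yes eq = trans (trans (cong (λ σ → heightAt (add σ (path s y)) (suc i)) eq) (heightAt-addSq-≡ i (path s y)))
                     (trans (cong suc (heightAt-path s y i)) (sym (length-row-≡ s (suc i) y eq)))
... | no σ≢ = trans (unchanged (s (suc y)) σ≢)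
                    (trans (heightAt-path s y i) (sym (length-row-≢ s (suc i) y σ≢)))
  where
  unchanged : ∀ σ → σ ≢ suc i → heightAt (add σ (path s y)) (suc i) ≡ heightAt (path s y) (suc i)
  unchanged zero    _   = refl
  unchanged (suc r) r≢i = heightAt-addSq-≢ r (path s y) i (r≢i ∘ cong suc)

sumTo-cong : ∀ n {f g : ℕ → ℕ} → (∀ i → f (suc i) ≡ g (suc i)) → sumTo n f ≡ sumTo n g
sumTo-cong zero    h = refl
sumTo-cong (suc n) h = cong₂ _+_ (sumTo-cong n h) (h n)

length-reading : ∀ s n y → length (reading s n y) ≡ sumTo n (λ i → length (row s i y))
length-reading s zero    y = refl
length-reading s (suc n) y = trans (length-++ (row s (suc n) y))
  (trans (+-comm (length (row s (suc n) y)) _) (cong (_+ length (row s (suc n) y)) (length-reading s n y)))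

module _ (s : ℕ → ℕ) (y : ℕ) where

  -- The colour of a letter is its row, counted from 0, so the colours below `k` are the first `k`
  -- rows of the tableau.
  byRow : ℕ → List (ℕ × ℕ)
  byRow zero    = []
  byRow (suc i) = map (_, i) (row s (suc i) y) ++ byRow i

  map-proj₁-byRow : ∀ n → map proj₁ (byRow n) ≡ reading s n y
  map-proj₁-byRow zero    = refl
  map-proj₁-byRow (suc n) = trans (map-++ proj₁ (map (_, n) (row s (suc n) y)) _)
    (cong₂ _++_ (trans (sym (map-∘ (row s (suc n) y))) (map-id _)) (map-proj₁-byRow n))

  byRow-colours : ∀ n → All (λ p → proj₂ p < n) (byRow n)
  byRow-colours zero    = []
  byRow-colours (suc n) = AllP.++⁺ (AllP.map⁺ (All.universal (λ _ → ≤-refl) _)) (All.map m≤n⇒m≤1+n (byRow-colours n))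

  byRow-compatible : ∀ k n → AllPairs (Compatible _<_ k) (byRow n)
  byRow-compatible k zero    = []
  byRow-compatible k (suc n) = APP.++⁺
    (APP.map⁺ (AllPairs.map (λ v<v' _ _ → v<v') (row-sorted s (suc n) y)))
    (byRow-compatible k n)
    (AllP.map⁺ (All.universal (λ _ → All.map (λ c<n n≡c → ⊥-elim (<⇒≢ c<n (sym n≡c))) (byRow-colours n)) _))

  active-constant-< : ∀ {k c} → c < k → (vs : List ℕ) → active k (map (_, c) vs) ≡ length vs
  active-constant-< c<k []       = refl
  active-constant-< {k} {c} c<k (v ∷ vs) = cong₂ _+_ (ind-yes (c <? k) c<k) (active-constant-< c<k vs)

  active-constant-≮ : ∀ {k c} → ¬ c < k → (vs : List ℕ) → active k (map (_, c) vs) ≡ 0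
  active-constant-≮ c≮k []       = refl
  active-constant-≮ {k} {c} c≮k (v ∷ vs) = cong₂ _+_ (ind-no (c <? k) c≮k) (active-constant-≮ c≮k vs)

  active-byRow : ∀ k n → n ≤ k → active k (byRow n) ≡ sumTo n (λ i → length (row s i y))
  active-byRow k zero    _   = refl
  active-byRow k (suc n) n<k = trans (∑-++ _ (map (_, n) (row s (suc n) y)) (byRow n))
    (trans (+-comm (active k (map (_, n) (row s (suc n) y))) _)
           (cong₂ _+_ (active-byRow k n (<⇒≤ n<k)) (active-constant-< n<k (row s (suc n) y))))

  active-byRow-+ : ∀ k d → active k (byRow (d + k)) ≡ sumTo k (λ i → length (row s i y))
  active-byRow-+ k zero    = active-byRow k k ≤-refl
  active-byRow-+ k (suc d) = trans (∑-++ _ (map (_, d + k) (row s (suc d + k) y)) (byRow (d + k)))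
    (cong₂ _+_ (active-constant-≮ (≤⇒≯ (m≤n+m k d)) (row s (suc d + k) y)) (active-byRow-+ k d))

  reading-Colouring-< : ∀ k n → k ≤ n → Colouring _<_ k (sumTo k (λ i → length (row s i y))) (reading s n y)
  reading-Colouring-< k n k≤n = byRow n , map-proj₁-byRow n , byRow-compatible k n ,
    subst (λ h → active k (byRow h) ≡ _) (m∸n+n≡m k≤n) (active-byRow-+ k (n ∸ k))

-- Each entry of a row is paired with the number of its column.
numbered : (ℕ → ℕ) → ℕ → ℕ → List (ℕ × ℕ)
numbered s i zero    = []
numbered s i (suc y) = extend (s (suc y)) i (suc y , length (row s i y)) (numbered s i y)

map-proj₁-numbered : ∀ s i y → map proj₁ (numbered s i y) ≡ row s i y
map-proj₁-numbered s i zero    = refl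
map-proj₁-numbered s i (suc y) with does (s (suc y) ≟ i)
... | true  = trans (map-++ proj₁ (numbered s i y) _) (cong (_++ [ suc y ]) (map-proj₁-numbered s i y))
... | false = map-proj₁-numbered s i y

-- Remembers that the column number is the length of the row just before the entry arrived; this
-- lets entries of different rows be compared by their times of arrival.
data IsNumbered (s : ℕ → ℕ) (i : ℕ) : ℕ × ℕ → Set where
  numbering : ∀ {y} → s (suc y) ≡ i → IsNumbered s i (suc y , length (row s i y))

numbered-IsNumbered : ∀ s i y → All (IsNumbered s i) (numbered s i y)
numbered-IsNumbered s i zero    = []
numbered-IsNumbered s i (suc y) with s (suc y) ≟ i
... | yes refl rewrite ≟-refl (s (suc y)) = AllP.++⁺ (numbered-IsNumbered s i y) (numbering refl ∷ [])
... | no σ≢i   rewrite ≟-≢ σ≢i = numbered-IsNumbered s i y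

numbered-bounded : ∀ s i y → All (λ p → proj₂ p < length (row s i y)) (numbered s i y)
numbered-bounded s i zero    = []
numbered-bounded s i (suc y) with s (suc y) ≟ i
... | yes σ≡i rewrite length-row-≡ s i y σ≡i | dec-true (s (suc y) ≟ i) σ≡i =
  AllP.++⁺ (All.map m≤n⇒m≤1+n (numbered-bounded s i y)) (≤-refl ∷ [])
... | no σ≢i  rewrite ≟-≢ σ≢i = numbered-bounded s i y

numbered-distinct : ∀ s i y → AllPairs (_≢_ on proj₂) (numbered s i y)
numbered-distinct s i zero    = []
numbered-distinct s i (suc y) with does (s (suc y) ≟ i)
... | true  = APP.++⁺ (numbered-distinct s i y) ([] ∷ []) (All.map (λ c< → <⇒≢ c< ∷ []) (numbered-bounded s i y))
... | false = numbered-distinct s i y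

active-numbered : ∀ s i l y → active l (numbered s i y) ≡ length (row s i y) ⊓ l
active-numbered s i l zero    = refl
active-numbered s i l (suc y) with s (suc y) ≟ i
... | no σ≢i  rewrite ≟-≢ σ≢i = active-numbered s i l y
... | yes σ≡i rewrite length-row-≡ s i y σ≡i | dec-true (s (suc y) ≟ i) σ≡i =
  trans (∑-++ (λ p → ind (proj₂ p <? l)) (numbered s i y) _)
        (trans (cong (_+ (ind (n <? l) + 0)) (active-numbered s i l y)) (aux (n <? l)))
  where
  n : ℕ
  n = length (row s i y)

  aux : (n<?l : Dec (n < l)) → n ⊓ l + (ind (n <? l) + 0) ≡ suc n ⊓ l
  aux (yes n<l) rewrite ind-yes (n <? l) n<l | m≤n⇒m⊓n≡m (<⇒≤ n<l) | m≤n⇒m⊓n≡m n<l = +-comm n 1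
  aux (no n≮l)  rewrite ind-no (n <? l) n≮l | m≥n⇒m⊓n≡n (≮⇒≥ n≮l) | m≥n⇒m⊓n≡n (m≤n⇒m≤1+n (≮⇒≥ n≮l)) = +-identityʳ l

module _ {s : ℕ → ℕ} (lattice : IsLattice s) where

  lattice-≤ : ∀ y {i j} → i ≤ j → length (row s (suc j) y) ≤ length (row s (suc i) y)
  lattice-≤ y {i} {zero}  z≤n = ≤-refl
  lattice-≤ y {i} {suc j} i≤  with m≤n⇒m<n∨m≡n i≤
  ... | inj₁ (s≤s i≤j) = ≤-trans (lattice y j) (lattice-≤ y i≤j)
  ... | inj₂ refl      = ≤-refl

  -- If the entry of the upper row `suc j` came first, that row would already cover the common
  -- column at a time when the lower row `suc i` does not, against the lattice condition.
  column-strict : ∀ {i j p q} → i < j → IsNumbered s (suc j) p → IsNumbered s (suc i) q →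
                  proj₂ p ≡ proj₂ q → proj₁ q < proj₁ p
  column-strict {i} {j} i<j (numbering {v} σ≡j) (numbering {w} σ≡i) c≡d with <-cmp w v
  ... | tri< w<v _ _  = s≤s w<v
  ... | tri≈ _ refl _ = ⊥-elim (<⇒≢ i<j (suc-injective (trans (sym σ≡i) σ≡j)))
  ... | tri> _ _ v<w  = ⊥-elim (<⇒≢ (≤-trans (≤-reflexive (sym (length-row-≡ s (suc j) v σ≡j)))
      (≤-trans (lattice-≤ (suc v) (<⇒≤ i<j)) (length-row-mono s (suc i) v<w))) c≡d)

  byColumn : ℕ → ℕ → List (ℕ × ℕ)
  byColumn y zero    = []
  byColumn y (suc i) = numbered s (suc i) y ++ byColumn y i

  byColumn-IsNumbered : ∀ y n → All (λ p → ∃ λ i → i < n × IsNumbered s (suc i) p) (byColumn y n)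
  byColumn-IsNumbered y zero    = []
  byColumn-IsNumbered y (suc n) = AllP.++⁺
    (All.map (λ h → n , ≤-refl , h) (numbered-IsNumbered s (suc n) y))
    (All.map (λ (i , i<n , h) → i , m≤n⇒m≤1+n i<n , h) (byColumn-IsNumbered y n))

  byColumn-compatible : ∀ l y n → AllPairs (Compatible (flip _<_) l) (byColumn y n)
  byColumn-compatible l y zero    = []
  byColumn-compatible l y (suc n) = APP.++⁺
    (AllPairs.map (λ c≢c' c≡c' _ → ⊥-elim (c≢c' c≡c')) (numbered-distinct s (suc n) y))
    (byColumn-compatible l y n)
    (All.map (λ hp → All.map (λ (i , i<n , hq) c≡c' _ → column-strict i<n hp hq c≡c') (byColumn-IsNumbered y n))
      (numbered-IsNumbered s (suc n) y))

  map-proj₁-byColumn : ∀ y n → map proj₁ (byColumn y n) ≡ reading s n y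
  map-proj₁-byColumn y zero    = refl
  map-proj₁-byColumn y (suc n) = trans (map-++ proj₁ (numbered s (suc n) y) _)
    (cong₂ _++_ (map-proj₁-numbered s (suc n) y) (map-proj₁-byColumn y n))

  active-byColumn : ∀ l y n → active l (byColumn y n) ≡ sumTo n (λ i → length (row s i y) ⊓ l)
  active-byColumn l y zero    = refl
  active-byColumn l y (suc n) = trans (∑-++ (λ p → ind (proj₂ p <? l)) (numbered s (suc n) y) _)
    (trans (+-comm (active l (numbered s (suc n) y)) _) (cong₂ _+_ (active-byColumn l y n) (active-numbered s (suc n) l y)))

  reading-Colouring-> : ∀ l n y → Colouring (flip _<_) l (sumTo n (λ i → length (row s i y) ⊓ l)) (reading s n y)
  reading-Colouring-> l n y = byColumn y n , map-proj₁-byColumn y n , byColumn-compatible l y n , active-byColumn l y n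

-- Greene's theorem for partial permutations: existence

module Greene {g : ℕ → ℕ → ℕ} (pp : IsPartialPermutation g) where

  open Rows g
  module Ins (x : ℕ) = Insertion (rowIn x) (g (suc x))

  -- The nonzero positions, collected from the insertions into row 1; `points⁻` and `points⁺`
  -- identify them with the support of `g`. In this form the word grows by exactly the letters that
  -- `reading-next` splits off.
  points : ℕ → ℕ → List (ℕ × ℕ)
  points zero    y = []
  points (suc x) y = points x y ++ map (suc x ,_) (Ins.entering x 1 y)

  word : ℕ → ℕ → List ℕ
  word x y = map proj₂ (points x y)

  word-suc : ∀ x y → word (suc x) y ≡ word x y ++ Ins.entering x 1 y
  word-suc x y = trans (map-++ proj₂ (points x y) _)
    (cong (word x y ++_) (trans (sym (map-∘ (Ins.entering x 1 y))) (map-id _)))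

  points⁻ : ∀ x y {p} → p ∈ points x y → (1 ≤ proj₁ p × proj₁ p ≤ x) × (1 ≤ proj₂ p × proj₂ p ≤ y) × g (proj₁ p) (proj₂ p) ≢ 0
  points⁻ (suc x) y p∈ with ∈-++⁻ (points x y) p∈
  ... | inj₁ p∈' with points⁻ x y p∈'
  ...   | (1≤ , ≤x) , rest = (1≤ , m≤n⇒m≤1+n ≤x) , rest
  points⁻ (suc x) y p∈ | inj₂ p∈' with ∈-map⁻ (suc x ,_) p∈'
  ...   | v , v∈ , refl with Ins.entering⁻ x y v∈
  ...     | 1≤v , v≤y , g≢0 = (s≤s z≤n , ≤-refl) , (1≤v , v≤y) , g≢0

  points⁺ : ∀ x y {v w} → suc v ≤ x → suc w ≤ y → g (suc v) (suc w) ≢ 0 → (suc v , suc w) ∈ points x y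
  points⁺ (suc x) y {v} {w} v<x w<y g≢0 with m≤n⇒m<n∨m≡n v<x
  ... | inj₁ (s≤s v<x') = ∈-++⁺ˡ (points⁺ x y v<x' w<y g≢0)
  ... | inj₂ refl with fresh pp v w g≢0
  ...   | s0 , b0 = ∈-++⁺ʳ (points x y) (∈-map⁺ (suc x ,_) (proj₁ (Ins.entering⁺ x y w<y s0 b0 g≢0)))

  points-sorted : ∀ x y → AllPairs (_<_ on proj₁) (points x y)
  points-sorted zero    y = []
  points-sorted (suc x) y = APP.++⁺ (points-sorted x y) (APP.map⁺ (short y))
    (All.tabulate (λ p∈ → AllP.map⁺ (All.universal (λ _ → s≤s (proj₂ (proj₁ (points⁻ x y p∈)))) _)))
    where
    -- At most one value enters row 1 in each column, so even an impossible relation holds for all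
    -- pairs.
    short : ∀ y → AllPairs (λ _ _ → suc x < suc x) (Ins.entering x 1 y)
    short y with Ins.rowState x 0 y
    ... | before _ _ eq _              = subst (AllPairs _) (sym eq) []
    ... | at _ _ _ _ eq _              = subst (AllPairs _) (sym eq) ([] ∷ [])
    ... | after _ _ _ _ _ _ _ _ eq _   = subst (AllPairs _) (sym eq) ([] ∷ [])

  rowIn≤ : ∀ x y → rowIn x y ≤ x
  rowIn≤ zero    y = z≤n
  rowIn≤ (suc x) y = Ins.next≤ x (rowIn≤ x) y

  rowIn-lattice : ∀ x → IsLattice (rowIn x)
  rowIn-lattice zero    y i = subst₂ _≤_ (sym (empty y (suc i))) (sym (empty y i)) z≤n
    where
    empty : ∀ y i → length (row (λ _ → 0) (suc i) y) ≡ 0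
    empty zero    i = refl
    empty (suc y) i = empty y i
  rowIn-lattice (suc x) = Ins.next-lattice x (rowIn-lattice x)

  reading-word : ∀ n x y → x ≤ n → reading (rowIn x) n y ↝* word x y
  reading-word n zero    y _   = subst (_↝* []) (sym (empty n)) ε
    where
    row≡[] : ∀ i y → row (λ _ → 0) (suc i) y ≡ []
    row≡[] i zero    = refl
    row≡[] i (suc y) = row≡[] i y

    empty : ∀ n → reading (λ _ → 0) n y ≡ []
    empty zero    = refl
    empty (suc n) = trans (cong (_++ reading (λ _ → 0) n y) (row≡[] n y)) (empty n)
  reading-word n (suc x) y x<n = subst₂ _↝*_
    (cong (_++ reading (rowIn (suc x)) n y)
      (Ins.entering≡[] x n y (≤-trans (Ins.bumped≤ x (rowIn≤ x) y) x<n)))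
    (sym (word-suc x y))
    (Ins.reading-next x n y ◅◅ ↝*-++ʳ (Ins.entering x 1 y) (reading-word n x y (<⇒≤ x<n)))

  module _ (x y : ℕ) where

    part : ℕ → ℕ
    part = heightAt (growth g x y)

    part≡length-row : ∀ i → part (suc i) ≡ length (row (rowIn x) (suc i) y)
    part≡length-row i = trans (cong (λ h → heightAt h (suc i)) (growth≡path pp x y)) (heightAt-path (rowIn x) y i)

    part-decreasing : ∀ i → part (suc (suc i)) ≤ part (suc i)
    part-decreasing i = subst₂ _≤_ (sym (part≡length-row (suc i))) (sym (part≡length-row i)) (rowIn-lattice x y i)

    part≡0 : ∀ i → x ≤ i → part (suc i) ≡ 0
    part≡0 i x≤i = trans (part≡length-row i) (go y)
      where
      go : ∀ y → length (row (rowIn x) (suc i) y) ≡ 0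
      go zero    = refl
      go (suc y) = trans (length-row-≢ (rowIn x) (suc i) y (<⇒≢ (s≤s (≤-trans (rowIn≤ x (suc y)) x≤i)))) (go y)

    length-points : ∀ n → x ≤ n → length (points x y) ≡ sumTo n part
    length-points n x≤n = begin
      length (points x y)                       ≡⟨ sym (length-map proj₂ (points x y)) ⟩
      length (word x y)                         ≡⟨ sym (length-↝* (reading-word n x y x≤n)) ⟩
      length (reading (rowIn x) n y)            ≡⟨ length-reading (rowIn x) n y ⟩
      sumTo n (λ i → length (row (rowIn x) i y)) ≡⟨ sumTo-cong n (λ i → sym (part≡length-row i)) ⟩
      sumTo n part                              ∎
      where open ≡-Reasoning

    increasing-chains : ∀ k → Colouring _<_ k (sumTo k part) (word x y)
    increasing-chains k = subst (λ h → Colouring _<_ k h (word x y)) (sumTo-cong k (λ i → sym (part≡length-row i)))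
      (Colouring-<-↝* (reading-word (x + k) x y (m≤m+n x k)) (reading-Colouring-< (rowIn x) y k (x + k) (m≤n+m k x)))

    decreasing-chains : ∀ l n → x ≤ n → Colouring (flip _<_) l (sumTo n (λ i → part i ⊓ l)) (word x y)
    decreasing-chains l n x≤n = subst (λ h → Colouring (flip _<_) l h (word x y))
      (sumTo-cong n (λ i → cong (_⊓ l) (sym (part≡length-row i))))
      (Colouring->-↝* (reading-word n x y x≤n) (reading-Colouring-> (rowIn-lattice x) l n y))

-- The geometry of the separated filling

sumTo-mono : ∀ (f : ℕ → ℕ) {m n} → m ≤ n → sumTo m f ≤ sumTo n f
sumTo-mono f {m} {zero}  z≤n = ≤-refl
sumTo-mono f {m} {suc n} m≤  with m≤n⇒m<n∨m≡n m≤
... | inj₁ (s≤s m≤n) = ≤-trans (sumTo-mono f m≤n) (m≤m+n _ _)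
... | inj₂ refl      = ≤-refl

sumTo-≢0⁻ : ∀ n (f : ℕ → ℕ) → sumTo n f ≢ 0 → ∃ λ i → (1 ≤ i × i ≤ n) × f i ≢ 0
sumTo-≢0⁻ zero    f ≢0 = ⊥-elim (≢0 refl)
sumTo-≢0⁻ (suc n) f ≢0 with f (suc n) ≟ 0
... | no f≢0 = suc n , (s≤s z≤n , ≤-refl) , f≢0
... | yes f≡0 with sumTo-≢0⁻ n f (λ eq → ≢0 (cong₂ _+_ eq f≡0))
...   | i , (1≤i , i≤n) , f≢0 = i , (1≤i , m≤n⇒m≤1+n i≤n) , f≢0

sumTo-≢0⁺ : ∀ {n i} (f : ℕ → ℕ) → 1 ≤ i → i ≤ n → f i ≢ 0 → sumTo n f ≢ 0
sumTo-≢0⁺ {n} {suc i} f 1≤i i≤n f≢0 eq =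
  f≢0 (m+n≡0⇒n≡0 (sumTo i f) (n≤0⇒n≡0 (subst (sumTo (suc i) f ≤_) eq (sumTo-mono f i≤n))))

heightAt-bound : ∀ hs j → 1 ≤ heightAt hs j → 1 ≤ j × j ≤ length hs
heightAt-bound (h ∷ hs) (suc zero)    _  = s≤s z≤n , s≤s z≤n
heightAt-bound (h ∷ hs) (suc (suc j)) 1≤ = s≤s z≤n , s≤s (proj₂ (heightAt-bound hs (suc j) 1≤))

NE SE : Cell → Cell → Set
NE (j , i) (j' , i') = j < j' × i < i'
SE (j , i) (j' , i') = j ≤ j' × i' ≤ i

Unit : Set
Unit = Cell × ℕ

GoodUnit : List ℕ → Filling → ℕ → ℕ → Unit → Set
GoodUnit hs f x y (c , t) = InR hs x y c × 1 ≤ t × t ≤ entryOf f c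

AllPairs-with : ∀ {A : Set} {P : A → Set} {R : Rel A 0ℓ} {xs} → All P xs → AllPairs R xs →
                AllPairs (λ a b → P a × P b × R a b) xs
AllPairs-with []       []       = []
AllPairs-with (p ∷ ps) (r ∷ rs) = All.zipWith (λ (q , r) → p , q , r) (ps , r) ∷ AllPairs-with ps rs

All-choose : ∀ {A B : Set} {Q : A → Set} (f : A → B) {ys} → All (λ y → ∃ λ x → Q x × f x ≡ y) ys →
             ∃ λ xs → map f xs ≡ ys × All Q xs
All-choose f []                     = [] , refl , []
All-choose f ((x , q , refl) ∷ ps) with All-choose f ps
... | xs , refl , qs = x ∷ xs , refl , q ∷ qs

attach : ∀ {A : Set} (h : A → ℕ) as (cs : List (ℕ × ℕ)) → map proj₁ cs ≡ map h as →
         ∃ λ (ds : List (A × ℕ)) → map proj₁ ds ≡ as × map (λ d → h (proj₁ d) , proj₂ d) ds ≡ cs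
attach h []       []             eq = [] , refl , refl
attach h (a ∷ as) ((v , c) ∷ cs) eq with ∷-injective eq
... | refl , eq' with attach h as cs eq'
...   | ds , refl , refl = (a , c) ∷ ds , refl , refl

Coloured : ∀ {A : Set} → (A → A → Set) → ℕ → ℕ → List A → Set
Coloured {A} _~_ k n as = ∃ λ (ds : List (A × ℕ)) → map proj₁ ds ≡ as ×
  AllPairs (λ (a , c) (a' , c') → c ≡ c' → c < k → a ~ a') ds × active k ds ≡ n

colour-points : ∀ {A : Set} {P : A → Set} {_≺_ : Rel ℕ 0ℓ} {_~_ : A → A → Set} {k n} (col row : A → ℕ) {as} →
  All P as → AllPairs (_<_ on col) as →
  (∀ {a a'} → P a → P a' → col a < col a' → row a ≺ row a' → a ~ a') →
  Colouring _≺_ k n (map row as) → Coloured _~_ k n as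
colour-points col row {as} valid sorted transfer (cs , eq , ps , count) with attach row as cs eq
... | ds , refl , refl = ds , refl ,
  AllPairs.map (λ (p , p' , c< , r) c≡c' c<k → transfer p p' c< (r c≡c' c<k))
    (AllPairs-with (AllP.map⁻ valid) (AllPairs.zip (APP.map⁻ sorted , APP.map⁻ ps))) ,
  trans (cong sum (map-∘ ds)) count

module Separation (hs : List ℕ) (f : Filling) where

  open DualRSK hs f

  Valid : Unit → Set
  Valid ((j , i) , t) = (1 ≤ j × j ≤ m) × (1 ≤ i × i ≤ heightAt hs j) × (1 ≤ t × t ≤ ent j i)

  colOf rowOf : Unit → ℕ
  colOf ((j , i) , t) = unitCol j i t
  rowOf ((j , i) , t) = unitRow j i t

  -- The left-to-right and bottom-to-top orders of the separated units. They are opposite on two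
  -- units of the same column, row or cell; hence units that agree in both orders lie in cells
  -- differing strictly in both coordinates.
  _<ᶜ_ _<ʳ_ : Rel Unit 0ℓ
  ((j , i) , t) <ᶜ ((j' , i') , t') = j < j' ⊎ (j ≡ j' × (i' < i ⊎ (i ≡ i' × t < t')))
  ((j , i) , t) <ʳ ((j' , i') , t') = i < i' ⊎ (i ≡ i' × (j' < j ⊎ (j ≡ j' × t' < t)))

  Xend-mono : ∀ {x x'} → x ≤ x' → Xend x ≤ Xend x'
  Xend-mono = sumTo-mono _

  Yend-mono : ∀ {y y'} → y ≤ y' → Yend y ≤ Yend y'
  Yend-mono = sumTo-mono _

  Xend<colOf : ∀ {j i t} → Valid ((j , i) , t) → ∀ {x} → x < j → Xend x < unitCol j i t
  Xend<colOf {suc j} {i} {t} (_ , _ , 1≤t , _) (s≤s x≤j) =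
    ≤-<-trans (≤-trans (Xend-mono x≤j) (m≤m+n _ _)) (m<m+n _ 1≤t)

  -- Splitting off cell i leaves exactly the units of the cells above it.
  after-cell : ∀ {j i t} → Valid ((j , suc i) , t) →
    colSum j ∸ sumTo (suc i) (ent j) + t ≤ colSum j ∸ sumTo i (ent j)
  after-cell {j} {i} {t} (_ , (_ , i≤h) , _ , t≤e) = begin
    colSum j ∸ sumTo (suc i) (ent j) + t               ≤⟨ +-monoʳ-≤ (colSum j ∸ sumTo (suc i) (ent j)) t≤e ⟩
    colSum j ∸ (sumTo i (ent j) + ent j (suc i)) + ent j (suc i)
      ≡⟨ cong (_+ ent j (suc i)) (sym (∸-+-assoc (colSum j) (sumTo i (ent j)) (ent j (suc i)))) ⟩
    colSum j ∸ sumTo i (ent j) ∸ ent j (suc i) + ent j (suc i)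
      ≡⟨ m∸n+n≡m (m+n≤o⇒m≤o∸n (ent j (suc i)) (subst (_≤ colSum j) (+-comm (sumTo i (ent j)) _) (sumTo-mono (ent j) i≤h))) ⟩
    colSum j ∸ sumTo i (ent j)                         ∎
    where open ≤-Reasoning

  colOf≤Xend : ∀ {j i t} → Valid ((j , i) , t) → ∀ {x} → j ≤ x → unitCol j i t ≤ Xend x
  colOf≤Xend {suc j} {suc i} {t} v {x} j<x = begin
    Xend j + (colSum (suc j) ∸ sumTo (suc i) (ent (suc j))) + t   ≡⟨ +-assoc (Xend j) _ t ⟩
    Xend j + (colSum (suc j) ∸ sumTo (suc i) (ent (suc j)) + t)   ≤⟨ +-monoʳ-≤ (Xend j) (after-cell v) ⟩
    Xend j + (colSum (suc j) ∸ sumTo i (ent (suc j)))             ≤⟨ +-monoʳ-≤ (Xend j) (m∸n≤m (colSum (suc j)) (sumTo i (ent (suc j)))) ⟩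
    Xend j + colSum (suc j)                                       ≤⟨ +-monoʳ-≤ (Xend j) (m≤m⊔n (colSum (suc j)) 1) ⟩
    Xend (suc j)                                                  ≤⟨ Xend-mono j<x ⟩
    Xend x                                                        ∎
    where open ≤-Reasoning
  colOf≤Xend {zero} ((() , _) , _) _
  colOf≤Xend {suc j} {zero} (_ , (() , _) , _) _

  colOf-mono : ∀ {u u'} → Valid u → Valid u' → u <ᶜ u' → colOf u < colOf u'
  colOf-mono v v' (inj₁ j<j') = ≤-<-trans (colOf≤Xend v ≤-refl) (Xend<colOf v' j<j')
  colOf-mono {(j , suc i) , t} {(_ , i') , t'} v (_ , _ , 1≤t' , _) (inj₂ (refl , inj₁ (s≤s i'≤i))) = begin-strict
    Xend (pred j) + (colSum j ∸ sumTo (suc i) (ent j)) + t   ≡⟨ +-assoc (Xend (pred j)) _ t ⟩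
    Xend (pred j) + (colSum j ∸ sumTo (suc i) (ent j) + t)   ≤⟨ +-monoʳ-≤ (Xend (pred j)) (after-cell v) ⟩
    Xend (pred j) + (colSum j ∸ sumTo i (ent j))             ≤⟨ +-monoʳ-≤ (Xend (pred j)) (∸-monoʳ-≤ (colSum j) (sumTo-mono (ent j) i'≤i)) ⟩
    Xend (pred j) + (colSum j ∸ sumTo i' (ent j))            <⟨ m<m+n _ 1≤t' ⟩
    Xend (pred j) + (colSum j ∸ sumTo i' (ent j)) + t'       ∎
    where open ≤-Reasoning
  colOf-mono v v' (inj₂ (refl , inj₂ (refl , t<t'))) = +-monoʳ-< _ t<t'

  before-unit : ∀ {j i t} → Valid ((j , i) , t) → sumTo (pred j) (λ j' → ent j' i) + t ≤ sumTo j (λ j' → ent j' i)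
  before-unit {suc j} (_ , _ , _ , t≤e) = +-monoʳ-≤ _ t≤e
  before-unit {zero} ((() , _) , _)

  Yend<rowOf : ∀ {j i t} → Valid ((j , i) , t) → ∀ {y} → y < i → Yend y < unitRow j i t
  Yend<rowOf {j} {suc i} {t} v@((_ , j≤m) , _) {y} (s≤s y≤i) = begin-strict
    Yend y                                  ≤⟨ Yend-mono y≤i ⟩
    Yend i                                  <⟨ ≤-refl ⟩
    suc (Yend i)                            ≡⟨ sym (m+n∸n≡m (suc (Yend i)) (rowSum (suc i))) ⟩
    suc (Yend i) + rowSum (suc i) ∸ rowSum (suc i)
      ≤⟨ ∸-monoˡ-≤ (rowSum (suc i)) (s≤s (+-monoʳ-≤ (Yend i) (m≤m⊔n (rowSum (suc i)) 1))) ⟩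
    suc (Yend (suc i)) ∸ rowSum (suc i)
      ≤⟨ ∸-monoʳ-≤ (suc (Yend (suc i))) (≤-trans (before-unit v) (sumTo-mono _ j≤m)) ⟩
    unitRow j (suc i) t                     ∎
    where open ≤-Reasoning

  rowOf≤Yend : ∀ {j i t} → Valid ((j , i) , t) → ∀ {y} → i ≤ y → unitRow j i t ≤ Yend y
  rowOf≤Yend {j} {i} {t} (_ , _ , 1≤t , _) i≤y =
    ≤-trans (∸-monoʳ-≤ (suc (Yend i)) (≤-trans 1≤t (m≤n+m t (sumTo (pred j) (λ j' → ent j' i))))) (Yend-mono i≤y)

  -- The truncated subtraction in `unitRow` does not underflow, as its strict monotonicity requires.
  within-row : ∀ {j i t} → Valid ((j , i) , t) → sumTo (pred j) (λ j' → ent j' i) + t ≤ suc (Yend i)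
  within-row {j} {suc i} v@((_ , j≤m) , _) = begin
    _                                ≤⟨ before-unit v ⟩
    sumTo j (λ j' → ent j' (suc i))  ≤⟨ sumTo-mono _ j≤m ⟩
    rowSum (suc i)                   ≤⟨ m≤m⊔n (rowSum (suc i)) 1 ⟩
    rowSum (suc i) ⊔ 1               ≤⟨ m≤n+m _ (Yend i) ⟩
    Yend (suc i)                     ≤⟨ n≤1+n _ ⟩
    suc (Yend (suc i))               ∎
    where open ≤-Reasoning
  within-row {i = zero} (_ , (() , _) , _)

  rowOf-mono : ∀ {u u'} → Valid u → Valid u' → u <ʳ u' → rowOf u < rowOf u'
  rowOf-mono v v' (inj₁ i<i') = ≤-<-trans (rowOf≤Yend v ≤-refl) (Yend<rowOf v' i<i')
  rowOf-mono {(suc j , i) , t} {(j' , _) , t'} v@(_ , _ , 1≤t , _) v' (inj₂ (refl , inj₁ (s≤s j'≤j))) =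
    ∸-monoʳ-< (≤-<-trans (≤-trans (before-unit v') (sumTo-mono _ j'≤j)) (m<m+n _ 1≤t)) (within-row v)
  rowOf-mono v v' (inj₂ (refl , inj₂ (refl , t'<t))) = ∸-monoʳ-< (+-monoʳ-< _ t'<t) (within-row v)

  -- With trichotomy, the strict monotonicity of `colOf` gives both its injectivity and the
  -- reflection of the order; `<ʳ-compare` does the same for `rowOf`.
  <ᶜ-compare : ∀ u u' → u <ᶜ u' ⊎ u ≡ u' ⊎ u' <ᶜ u
  <ᶜ-compare ((j , i) , t) ((j' , i') , t') with <-cmp j j' | <-cmp i i' | <-cmp t t'
  ... | tri< a _ _    | _             | _             = inj₁ (inj₁ a)
  ... | tri> _ _ a    | _             | _             = inj₂ (inj₂ (inj₁ a))
  ... | tri≈ _ refl _ | tri< a _ _    | _             = inj₂ (inj₂ (inj₂ (refl , inj₁ a)))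
  ... | tri≈ _ refl _ | tri> _ _ a    | _             = inj₁ (inj₂ (refl , inj₁ a))
  ... | tri≈ _ refl _ | tri≈ _ refl _ | tri< a _ _    = inj₁ (inj₂ (refl , inj₂ (refl , a)))
  ... | tri≈ _ refl _ | tri≈ _ refl _ | tri≈ _ refl _ = inj₂ (inj₁ refl)
  ... | tri≈ _ refl _ | tri≈ _ refl _ | tri> _ _ a    = inj₂ (inj₂ (inj₂ (refl , inj₂ (refl , a))))

  <ʳ-compare : ∀ u u' → u <ʳ u' ⊎ u ≡ u' ⊎ u' <ʳ u
  <ʳ-compare ((j , i) , t) ((j' , i') , t') with <-cmp i i' | <-cmp j j' | <-cmp t t'
  ... | tri< a _ _    | _             | _             = inj₁ (inj₁ a)
  ... | tri> _ _ a    | _             | _             = inj₂ (inj₂ (inj₁ a))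
  ... | tri≈ _ refl _ | tri< a _ _    | _             = inj₂ (inj₂ (inj₂ (refl , inj₁ a)))
  ... | tri≈ _ refl _ | tri> _ _ a    | _             = inj₁ (inj₂ (refl , inj₁ a))
  ... | tri≈ _ refl _ | tri≈ _ refl _ | tri< a _ _    = inj₂ (inj₂ (inj₂ (refl , inj₂ (refl , a))))
  ... | tri≈ _ refl _ | tri≈ _ refl _ | tri≈ _ refl _ = inj₂ (inj₁ refl)
  ... | tri≈ _ refl _ | tri≈ _ refl _ | tri> _ _ a    = inj₁ (inj₂ (refl , inj₂ (refl , a)))

  module _ {u u' : Unit} (v : Valid u) (v' : Valid u') where

    colOf-injective : colOf u ≡ colOf u' → u ≡ u'
    colOf-injective eq with <ᶜ-compare u u'
    ... | inj₁ a        = ⊥-elim (<⇒≢ (colOf-mono v v' a) eq)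
    ... | inj₂ (inj₁ a) = a
    ... | inj₂ (inj₂ a) = ⊥-elim (<⇒≢ (colOf-mono v' v a) (sym eq))

    rowOf-injective : rowOf u ≡ rowOf u' → u ≡ u'
    rowOf-injective eq with <ʳ-compare u u'
    ... | inj₁ a        = ⊥-elim (<⇒≢ (rowOf-mono v v' a) eq)
    ... | inj₂ (inj₁ a) = a
    ... | inj₂ (inj₂ a) = ⊥-elim (<⇒≢ (rowOf-mono v' v a) (sym eq))

    colOf-reflect : colOf u < colOf u' → u <ᶜ u'
    colOf-reflect lt with <ᶜ-compare u u'
    ... | inj₁ a           = a
    ... | inj₂ (inj₁ refl) = ⊥-elim (<-irrefl refl lt)
    ... | inj₂ (inj₂ a)    = ⊥-elim (<-asym lt (colOf-mono v' v a))

    rowOf-reflect : rowOf u < rowOf u' → u <ʳ u'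
    rowOf-reflect lt with <ʳ-compare u u'
    ... | inj₁ a           = a
    ... | inj₂ (inj₁ refl) = ⊥-elim (<-irrefl refl lt)
    ... | inj₂ (inj₂ a)    = ⊥-elim (<-asym lt (rowOf-mono v' v a))

    NE-cells : colOf u < colOf u' → rowOf u < rowOf u' → NE (proj₁ u) (proj₁ u')
    NE-cells c< r< with colOf-reflect c< | rowOf-reflect r<
    ... | inj₁ j<j' | inj₁ i<i' = j<j' , i<i'
    ... | inj₁ j<j' | inj₂ (_ , inj₁ j'<j)       = ⊥-elim (<-asym j<j' j'<j)
    ... | inj₁ j<j' | inj₂ (_ , inj₂ (j≡j' , _)) = ⊥-elim (<⇒≢ j<j' j≡j')
    ... | inj₂ (_ , inj₁ i'<i) | inj₁ i<i'       = ⊥-elim (<-asym i<i' i'<i)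
    ... | inj₂ (_ , inj₁ i'<i) | inj₂ (i≡i' , _) = ⊥-elim (<⇒≢ i'<i (sym i≡i'))
    ... | inj₂ (_ , inj₂ (i≡i' , _)) | inj₁ i<i' = ⊥-elim (<⇒≢ i<i' i≡i')
    ... | inj₂ (j≡j' , _) | inj₂ (_ , inj₁ j'<j) = ⊥-elim (<⇒≢ j'<j (sym j≡j'))
    ... | inj₂ (_ , inj₂ (_ , t<t')) | inj₂ (_ , inj₂ (_ , t'<t)) = ⊥-elim (<-asym t<t' t'<t)

  module _ {u u' : Unit} (v : Valid u) (v' : Valid u') where

    SE-cells : colOf u < colOf u' → rowOf u' < rowOf u → SE (proj₁ u) (proj₁ u')
    SE-cells c< r< = weaken (colOf-reflect v v' c<) , weaken (rowOf-reflect v' v r<)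
      where
      weaken : ∀ {a b : ℕ} {P : Set} → a < b ⊎ (a ≡ b × P) → a ≤ b
      weaken (inj₁ a<b)       = <⇒≤ a<b
      weaken (inj₂ (a≡b , _)) = ≤-reflexive a≡b

  gFill⁻ : ∀ {X Y} → gFill X Y ≢ 0 → ∃ λ u → Valid u × (colOf u , rowOf u) ≡ (X , Y)
  gFill⁻ {X} {Y} ≢0 with sumTo-≢0⁻ m _ ≢0
  ... | j , bj , ≢0ʲ with sumTo-≢0⁻ (heightAt hs j) _ ≢0ʲ
  ...   | i , bi , ≢0ⁱ with sumTo-≢0⁻ (ent j i) _ ≢0ⁱ
  ...     | t , bt , ≢0ᵗ with unitCol j i t ≟ X | unitRow j i t ≟ Y
  ...       | yes eqX | yes eqY = ((j , i) , t) , (bj , bi , bt) , cong₂ _,_ eqX eqY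
  ...       | no neX  | _ rewrite ≟-≢ neX = ⊥-elim (≢0ᵗ refl)
  ...       | yes eqX | no neY rewrite dec-true (unitCol j i t ≟ X) eqX | ≟-≢ neY = ⊥-elim (≢0ᵗ refl)

  gFill⁺ : ∀ {u} → Valid u → gFill (colOf u) (rowOf u) ≢ 0
  gFill⁺ {(j , i) , t} ((1≤j , j≤m) , (1≤i , i≤h) , (1≤t , t≤e)) =
    sumTo-≢0⁺ _ 1≤j j≤m (sumTo-≢0⁺ _ 1≤i i≤h (sumTo-≢0⁺ _ 1≤t t≤e one))
    where
    one : (if does (unitCol j i t ≟ unitCol j i t) ∧ does (unitRow j i t ≟ unitRow j i t) then 1 else 0) ≢ 0
    one rewrite ≟-refl (unitCol j i t) | ≟-refl (unitRow j i t) = λ ()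

  gFill-IsPartialPermutation : IsPartialPermutation gFill
  gFill-IsPartialPermutation = record { one-per-column = one-col ; one-per-row = one-row }
    where
    one-col : ∀ {X Y Y'} → gFill X Y ≢ 0 → gFill X Y' ≢ 0 → Y ≡ Y'
    one-col h h' with gFill⁻ h | gFill⁻ h'
    ... | u , v , refl | u' , v' , eq' with colOf-injective v v' (sym (cong proj₁ eq'))
    ...   | refl = cong proj₂ eq'

    one-row : ∀ {X X' Y} → gFill X Y ≢ 0 → gFill X' Y ≢ 0 → X ≡ X'
    one-row h h' with gFill⁻ h | gFill⁻ h'
    ... | u , v , refl | u' , v' , eq' with rowOf-injective v v' (sym (cong proj₂ eq'))
    ...   | refl = cong proj₁ eq'

  ent≡ : ∀ {j i} → i ≤ heightAt hs j → ent j i ≡ f j i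
  ent≡ {j} {i} i≤h rewrite dec-true (i ≤? heightAt hs j) i≤h = refl

  module AtCorner (x y : ℕ) where

    open Greene gFill-IsPartialPermutation
    private
      X = Xend x
      Y = Yend y

    private
      pos : Unit → ℕ × ℕ
      pos u = colOf u , rowOf u

      Inside : Unit → Set
      Inside u = Valid u × GoodUnit hs f x y u

      -- The block ends `X` and `Y` separate the units of columns up to `x` and rows up to `y` from
      -- all others, so a point below both comes from a cell of the region.
      locate : ∀ {p} → p ∈ points X Y → ∃ λ u → Inside u × pos u ≡ p
      locate p∈ with points⁻ X Y p∈
      ... | (_ , c≤) , (_ , r≤) , g≢0 with gFill⁻ g≢0
      ...   | u@((j , i) , t) , v@(_ , (1≤i , i≤h) , (1≤t , t≤e)) , refl =
        u , (v , ((1≤i , i≤h) , ≮⇒≥ (λ x<j → <⇒≱ (Xend<colOf v x<j) c≤) , ≮⇒≥ (λ y<i → <⇒≱ (Yend<rowOf v y<i) r≤))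
               , 1≤t , subst (t ≤_) (ent≡ i≤h) t≤e) , refl

      located : ∃ λ us → map pos us ≡ points X Y × All Inside us
      located = All-choose pos (All.tabulate locate)

    units : List Unit
    units = proj₁ located

    units-Good : All (GoodUnit hs f x y) units
    units-Good = All.map proj₂ (proj₂ (proj₂ located))

    units-sorted : AllPairs (_<_ on colOf) units
    units-sorted = APP.map⁻ (subst (AllPairs (_<_ on proj₁)) (sym (proj₁ (proj₂ located))) (points-sorted X Y))

    units-Unique : Unique units
    units-Unique = AllPairs.map (λ { lt refl → <-irrefl refl lt }) units-sorted

    length-units : ∀ n → X ≤ n → length units ≡ sumTo n (part X Y)
    length-units n X≤n = trans (sym (length-map pos units))
      (trans (cong length (proj₁ (proj₂ located))) (length-points X Y n X≤n))

    units-complete : ∀ {u} → GoodUnit hs f x y u → u ∈ units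
    units-complete {u@((j , i) , t)} (((1≤i , i≤h) , j≤x , i≤y) , 1≤t , t≤f) =
      found (∈-map⁻ pos (subst (pos u ∈_) (sym (proj₁ (proj₂ located)))
        (inPoints (Xend<colOf v 1≤j) (Yend<rowOf v 1≤i) (colOf≤Xend v j≤x) (rowOf≤Yend v i≤y) (gFill⁺ v))))
      where
      1≤j = proj₁ (heightAt-bound hs j (≤-trans 1≤i i≤h))

      v : Valid u
      v = heightAt-bound hs j (≤-trans 1≤i i≤h) , (1≤i , i≤h) , (1≤t , subst (t ≤_) (sym (ent≡ i≤h)) t≤f)

      inPoints : ∀ {a b} → 1 ≤ a → 1 ≤ b → a ≤ X → b ≤ Y → gFill a b ≢ 0 → (a , b) ∈ points X Y
      inPoints {suc a} {suc b} _ _ a≤ b≤ ≢0 = points⁺ X Y a≤ b≤ ≢0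

      found : (∃ λ u' → u' ∈ units × pos u ≡ pos u') → u ∈ units
      found (u' , u'∈ , eq) = subst (_∈ units)
        (sym (colOf-injective v (proj₁ (All.lookup (proj₂ (proj₂ located)) u'∈)) (cong proj₁ eq))) u'∈

    private
      word≡ : map rowOf units ≡ word X Y
      word≡ = trans (map-∘ units) (cong (map proj₂) (proj₁ (proj₂ located)))

      units-Valid : All Valid units
      units-Valid = All.map proj₁ (proj₂ (proj₂ located))

    NE-units : ∀ k → Coloured (NE on proj₁) k (sumTo k (part X Y)) units
    NE-units k = colour-points colOf rowOf units-Valid units-sorted NE-cells
      (subst (Colouring _<_ k _) (sym word≡) (increasing-chains X Y k))

    SE-units : ∀ l n → X ≤ n → Coloured (SE on proj₁) l (sumTo n (λ i → part X Y i ⊓ l)) units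
    SE-units l n X≤n = colour-points colOf rowOf units-Valid units-sorted SE-cells
      (subst (Colouring (flip _<_) l _) (sym word≡) (decreasing-chains X Y l n X≤n))

-- Conjugate partitions

sumTo-+ : ∀ n (f g : ℕ → ℕ) → sumTo n (λ i → f i + g i) ≡ sumTo n f + sumTo n g
sumTo-+ zero    f g = refl
sumTo-+ (suc n) f g = trans (cong (_+ (f (suc n) + g (suc n))) (sumTo-+ n f g))
  (interchange (sumTo n f) (sumTo n g) (f (suc n)) (g (suc n)))

sumTo-shift : ∀ n (f : ℕ → ℕ) → sumTo (suc n) f ≡ f 1 + sumTo n (f ∘ suc)
sumTo-shift zero    f = sym (+-identityʳ (f 1))
sumTo-shift (suc n) f = trans (cong (_+ f (suc (suc n))) (sumTo-shift n f)) (+-assoc (f 1) _ _)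

sumTo-zero : ∀ n {f : ℕ → ℕ} → (∀ i → f (suc i) ≡ 0) → sumTo n f ≡ 0
sumTo-zero zero    h = refl
sumTo-zero (suc n) h = cong₂ _+_ (sumTo-zero n h) (h n)

partSum≡sumTo : ∀ k p → partSum k p ≡ sumTo k (heightAt p)
partSum≡sumTo zero    p       = refl
partSum≡sumTo (suc k) []      = sym (sumTo-zero (suc k) (λ _ → refl))
partSum≡sumTo (suc k) (a ∷ p) = trans (cong (a +_) (partSum≡sumTo k p))
  (sym (trans (sumTo-shift k (heightAt (a ∷ p))) (cong (a +_) (sumTo-cong k (λ _ → refl)))))

∑≡sumTo : ∀ (φ : ℕ → ℕ) → φ 0 ≡ 0 → ∀ n p → (∀ i → n ≤ i → heightAt p (suc i) ≡ 0) →
          ∑ φ p ≡ sumTo n (φ ∘ heightAt p)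
∑≡sumTo φ φ0 n       []      h = sym (sumTo-zero n (λ _ → φ0))
∑≡sumTo φ φ0 zero    (a ∷ p) h = cong₂ _+_ (trans (cong φ (h 0 z≤n)) φ0)
  (∑≡sumTo φ φ0 zero p (λ i _ → h (suc i) z≤n))
∑≡sumTo φ φ0 (suc n) (a ∷ p) h = trans (cong (φ a +_) (∑≡sumTo φ φ0 n p (λ i n≤i → h (suc i) (s≤s n≤i))))
  (sym (trans (sumTo-shift n (φ ∘ heightAt (a ∷ p))) (cong (φ a +_) (sumTo-cong n (λ _ → refl)))))

#≥ : ℕ → Partition → ℕ
#≥ j p = length (filter (λ b → j ≤? b) p)

heightAt-applyUpTo : ∀ (g : ℕ → ℕ) n i → (n ≤ i → g i ≡ 0) → heightAt (applyUpTo g n) (suc i) ≡ g i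
heightAt-applyUpTo g zero    i       h = sym (h z≤n)
heightAt-applyUpTo g (suc n) zero    h = refl
heightAt-applyUpTo g (suc n) (suc i) h = heightAt-applyUpTo (g ∘ suc) n i (λ n≤i → h (s≤s n≤i))

#≥≡0 : ∀ j p → All (_< j) p → #≥ j p ≡ 0
#≥≡0 j []      []         = refl
#≥≡0 j (a ∷ p) (a<j ∷ ps) =
  trans (cong length (filter-reject (j ≤?_) {xs = p} (<⇒≱ a<j))) (#≥≡0 j p ps)

-- The list `conj p` stops at the first part. Monotonicity makes that part the largest, so the
-- counts beyond the end are indeed 0.
heightAt-conj : ∀ p → (∀ i → heightAt p (suc (suc i)) ≤ heightAt p (suc i)) →
                ∀ i → heightAt (conj p) (suc i) ≡ #≥ (suc i) p
heightAt-conj []      dec i = refl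
heightAt-conj (a ∷ p) dec i =
  trans (cong (λ q → heightAt q (suc i)) (map-upTo (λ i → #≥ (suc i) (a ∷ p)) a))
    (heightAt-applyUpTo (λ i → #≥ (suc i) (a ∷ p)) a i
      (λ a≤i → #≥≡0 (suc i) (a ∷ p) (All.map (λ b≤a → s≤s (≤-trans b≤a a≤i)) (≤-refl ∷ bounded p dec))))
  where
  bounded : ∀ {a} q → (∀ i → heightAt (a ∷ q) (suc (suc i)) ≤ heightAt (a ∷ q) (suc i)) → All (_≤ a) q
  bounded []      _   = []
  bounded (b ∷ q) dec = dec 0 ∷ All.map (λ c≤b → ≤-trans c≤b (dec 0)) (bounded q (dec ∘ suc))

sumTo-≤ : ∀ l a → sumTo l (λ j → ind (j ≤? a)) ≡ a ⊓ l
sumTo-≤ zero    a = sym (⊓-zeroʳ a)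
sumTo-≤ (suc l) a with suc l ≤? a
... | yes l<a = trans (cong₂ _+_ (sumTo-≤ l a) (ind-yes (suc l ≤? a) l<a))
  (trans (cong (_+ 1) (m≥n⇒m⊓n≡n (<⇒≤ l<a))) (trans (+-comm l 1) (sym (m≥n⇒m⊓n≡n l<a))))
... | no l≮a = trans (cong₂ _+_ (sumTo-≤ l a) (ind-no (suc l ≤? a) l≮a))
  (trans (+-identityʳ _) (trans (m≤n⇒m⊓n≡m (≮⇒≥ l≮a)) (sym (m≤n⇒m⊓n≡m (m≤n⇒m≤1+n (≮⇒≥ l≮a))))))

length-filter-∷ : ∀ {A : Set} {P : A → Set} (P? : ∀ a → Dec (P a)) a as →
                  length (filter P? (a ∷ as)) ≡ ind (P? a) + length (filter P? as)
length-filter-∷ P? a as with does (P? a)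
... | true  = refl
... | false = refl

sumTo-#≥ : ∀ l p → sumTo l (λ j → #≥ j p) ≡ ∑ (_⊓ l) p
sumTo-#≥ l []      = sumTo-zero l (λ _ → refl)
sumTo-#≥ l (a ∷ p) = begin
  sumTo l (λ j → #≥ j (a ∷ p))                       ≡⟨ sumTo-cong l (λ i → length-filter-∷ (suc i ≤?_) a p) ⟩
  sumTo l (λ j → ind (j ≤? a) + #≥ j p)              ≡⟨ sumTo-+ l (λ j → ind (j ≤? a)) (λ j → #≥ j p) ⟩
  sumTo l (λ j → ind (j ≤? a)) + sumTo l (λ j → #≥ j p) ≡⟨ cong₂ _+_ (sumTo-≤ l a) (sumTo-#≥ l p) ⟩
  (a ⊓ l) + ∑ (_⊓ l) p                               ∎
  where open ≡-Reasoning

-- The squares in the first `l` columns are counted by rows.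
partSum-conj : ∀ l n p → (∀ i → heightAt p (suc (suc i)) ≤ heightAt p (suc i)) →
  (∀ i → n ≤ i → heightAt p (suc i) ≡ 0) → partSum l (conj p) ≡ sumTo n (λ i → heightAt p i ⊓ l)
partSum-conj l n p dec h = begin
  partSum l (conj p)              ≡⟨ partSum≡sumTo l (conj p) ⟩
  sumTo l (heightAt (conj p))     ≡⟨ sumTo-cong l (heightAt-conj p dec) ⟩
  sumTo l (λ j → #≥ j p)          ≡⟨ sumTo-#≥ l p ⟩
  ∑ (_⊓ l) p                      ≡⟨ ∑≡sumTo (_⊓ l) refl n p h ⟩
  sumTo n (λ i → heightAt p i ⊓ l) ∎
  where open ≡-Reasoning

-- Rectangles touching the boundary of a shape

module Decreasing (L : ℕ → ℕ) (dec : ∀ i → L (suc (suc i)) ≤ L (suc i)) where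

  antitone : ∀ {i j} → i ≤ j → L (suc j) ≤ L (suc i)
  antitone {i} {zero}  z≤n = ≤-refl
  antitone {i} {suc j} i≤  with m≤n⇒m<n∨m≡n i≤
  ... | inj₁ (s≤s i≤j) = ≤-trans (dec j) (antitone i≤j)
  ... | inj₂ refl      = ≤-refl

  -- The rectangle with k rows and l columns has its corner on the boundary of the shape L.
  Touches : ℕ → ℕ → Set
  Touches k l = (∀ i → i < k → l ≤ L (suc i)) × (∀ i → k ≤ i → L (suc i) ≤ l)

  touches-part : ∀ k → Touches (suc k) (L (suc k))
  touches-part k = (λ { i (s≤s i≤k) → antitone i≤k }) , (λ i k<i → antitone (<⇒≤ k<i))

  -- The search descends from `n` to the last row of length at least `l`, and ends at 0 if there is
  -- none.
  touching-row : ∀ l n → (∀ i → n ≤ i → L (suc i) ≡ 0) → ∃ λ k → k ≤ n × Touches k l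
  touching-row l n h = go n ≤-refl (λ i n≤i → ≤-trans (≤-reflexive (h i n≤i)) z≤n)
    where
    go : ∀ k → k ≤ n → (∀ i → k ≤ i → L (suc i) ≤ l) → ∃ λ k → k ≤ n × Touches k l
    go zero    _   above = 0 , z≤n , (λ _ ()) , above
    go (suc k) k<n above with l ≤? L (suc k)
    ... | yes l≤ = suc k , k<n , (λ { i (s≤s i≤k) → ≤-trans l≤ (antitone i≤k) }) , above
    ... | no l≰  = go k (<⇒≤ k<n) (λ i k≤i → ≤-trans (antitone k≤i) (<⇒≤ (≰⇒> l≰)))

  -- Truncation at `l` leaves exactly `l` in each of the first `k` rows and does not change the
  -- later ones, so the first sum is the size of the rectangle plus the rows beyond `k`.
  touches-sum : ∀ {k l} n → k ≤ n → Touches k l → sumTo n (λ i → L i ⊓ l) + sumTo k L ≡ sumTo n L + k * l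
  touches-sum {k} {l} n k≤n (below , above) =
    subst (λ h → sumTo h (λ i → L i ⊓ l) + sumTo k L ≡ sumTo h L + k * l) (m∸n+n≡m k≤n) (outside (n ∸ k))
    where
    inside : ∀ j → j ≤ k → sumTo j (λ i → L i ⊓ l) ≡ j * l
    inside zero    _   = refl
    inside (suc j) j<k = trans (cong₂ _+_ (inside j (<⇒≤ j<k)) (m≥n⇒m⊓n≡n (below j j<k))) (+-comm (j * l) l)

    outside : ∀ d → sumTo (d + k) (λ i → L i ⊓ l) + sumTo k L ≡ sumTo (d + k) L + k * l
    outside zero    = trans (cong (_+ sumTo k L) (inside k ≤-refl)) (+-comm (k * l) _)
    outside (suc d) = begin
      sumTo (d + k) (λ i → L i ⊓ l) + L (suc d + k) ⊓ l + sumTo k L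
        ≡⟨ cong (λ h → sumTo (d + k) (λ i → L i ⊓ l) + h + sumTo k L) (m≤n⇒m⊓n≡m (above (d + k) (m≤n+m k d))) ⟩
      sumTo (d + k) (λ i → L i ⊓ l) + L (suc d + k) + sumTo k L
        ≡⟨ xy∙z≈xz∙y (sumTo (d + k) (λ i → L i ⊓ l)) (L (suc d + k)) (sumTo k L) ⟩
      sumTo (d + k) (λ i → L i ⊓ l) + sumTo k L + L (suc d + k)
        ≡⟨ cong (_+ L (suc d + k)) (outside d) ⟩
      sumTo (d + k) L + k * l + L (suc d + k)
        ≡⟨ xy∙z≈xz∙y (sumTo (d + k) L) (k * l) (L (suc d + k)) ⟩
      sumTo (d + k) L + L (suc d + k) + k * l ∎
      where open ≡-Reasoning

-- Counting occurrences

module _ {A : Set} where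

  ∑-mono : ∀ {φ ψ : A → ℕ} xs → (∀ {a} → a ∈ xs → φ a ≤ ψ a) → ∑ φ xs ≤ ∑ ψ xs
  ∑-mono []       h = z≤n
  ∑-mono (x ∷ xs) h = +-mono-≤ (h (here refl)) (∑-mono xs (h ∘ there))

  ∑-+ : ∀ (φ ψ : A → ℕ) xs → ∑ (λ a → φ a + ψ a) xs ≡ ∑ φ xs + ∑ ψ xs
  ∑-+ φ ψ []       = refl
  ∑-+ φ ψ (x ∷ xs) = trans (cong (φ x + ψ x +_) (∑-+ φ ψ xs)) (interchange (φ x) (ψ x) (∑ φ xs) (∑ ψ xs))

  ∑-zero : ∀ {φ : A → ℕ} xs → (∀ {a} → a ∈ xs → φ a ≡ 0) → ∑ φ xs ≡ 0
  ∑-zero []       h = refl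
  ∑-zero (x ∷ xs) h = cong₂ _+_ (h (here refl)) (∑-zero xs (h ∘ there))

  ∑-one : ∀ (xs : List A) → ∑ (λ _ → 1) xs ≡ length xs
  ∑-one []       = refl
  ∑-one (x ∷ xs) = cong suc (∑-one xs)

  ∈⇒≤∑ : ∀ (φ : A → ℕ) {a xs} → a ∈ xs → φ a ≤ ∑ φ xs
  ∈⇒≤∑ φ (here refl) = m≤m+n _ _
  ∈⇒≤∑ φ (there a∈)  = ≤-trans (∈⇒≤∑ φ a∈) (m≤n+m _ _)

  ∑-concat : ∀ (φ : A → ℕ) xss → ∑ (∑ φ) xss ≡ ∑ φ (concat xss)
  ∑-concat φ []         = refl
  ∑-concat φ (xs ∷ xss) = trans (cong (∑ φ xs +_) (∑-concat φ xss)) (sym (∑-++ φ xs (concat xss)))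

  ∑-supported-once : ∀ (φ : A → ℕ) {xs} → Unique xs → (∀ a → φ a ≤ 1) →
    (∀ {a b} → φ a ≢ 0 → φ b ≢ 0 → a ≡ b) → ∑ φ xs ≤ 1
  ∑-supported-once φ {[]}     _          _  _    = z≤n
  ∑-supported-once φ {x ∷ xs} (x∉ ∷ xs!) ≤1 once with φ x ≟ 0
  ... | yes φx≡0 = subst (λ h → h + ∑ φ xs ≤ 1) (sym φx≡0) (∑-supported-once φ xs! ≤1 once)
  ... | no φx≢0 = subst (λ h → φ x + h ≤ 1) (sym (∑-zero xs vanish)) (subst (_≤ 1) (sym (+-identityʳ (φ x))) (≤1 x))
    where
    vanish : ∀ {a} → a ∈ xs → φ a ≡ 0
    vanish {a} a∈ with φ a ≟ 0
    ... | yes φa≡0 = φa≡0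
    ... | no  φa≢0 = ⊥-elim (All.lookup x∉ a∈ (once φx≢0 φa≢0))

  AllPairs-lookup : ∀ {R : Rel A 0ℓ} {xs a b} → AllPairs R xs → a ∈ xs → b ∈ xs → a ≡ b ⊎ R a b ⊎ R b a
  AllPairs-lookup (p ∷ ps) (here refl) (here refl) = inj₁ refl
  AllPairs-lookup (p ∷ ps) (here refl) (there b∈)  = inj₂ (inj₁ (All.lookup p b∈))
  AllPairs-lookup (p ∷ ps) (there a∈)  (here refl) = inj₂ (inj₂ (All.lookup p a∈))
  AllPairs-lookup (p ∷ ps) (there a∈)  (there b∈)  = AllPairs-lookup ps a∈ b∈

module Occurrences {A : Set} (_≟ᴬ_ : DecidableEquality A) where

  occ : A → List A → ℕ
  occ a = ∑ (λ b → ind (a ≟ᴬ b))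

  occ-∈ : ∀ {a xs} → a ∈ xs → 1 ≤ occ a xs
  occ-∈ {a} {xs} a∈ = subst (_≤ occ a xs) (ind-yes (a ≟ᴬ a) refl) (∈⇒≤∑ (λ b → ind (a ≟ᴬ b)) a∈)

  occ-∉ : ∀ {a xs} → a ∉ xs → occ a xs ≡ 0
  occ-∉ {a} {xs} a∉ = ∑-zero xs (λ {b} b∈ → ind-no (a ≟ᴬ b) (λ { refl → a∉ b∈ }))

  occ-≢0 : ∀ {a xs} → occ a xs ≢ 0 → a ∈ xs
  occ-≢0 {a} {xs} ≢0 with any? (a ≟ᴬ_) xs
  ... | yes a∈ = a∈
  ... | no  a∉ = ⊥-elim (≢0 (occ-∉ a∉))

  ind-≟-≢0 : ∀ {a b} → ind (a ≟ᴬ b) ≢ 0 → a ≡ b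
  ind-≟-≢0 {a} {b} ≢0 with a ≟ᴬ b
  ... | yes a≡b = a≡b
  ... | no  a≢b = ⊥-elim (≢0 refl)

  occ-Unique : ∀ a {xs} → Unique xs → occ a xs ≤ 1
  occ-Unique a xs! = ∑-supported-once _ xs! (λ b → ind≤1 (a ≟ᴬ b))
    (λ ≢0 ≢0' → trans (sym (ind-≟-≢0 ≢0)) (ind-≟-≢0 ≢0'))

  -- The terms are regrouped by value. Repetitions in `ys` only enlarge the right-hand side.
  ∑≤∑-occ : ∀ (φ : A → ℕ) xs {ys} → (∀ {a} → a ∈ xs → a ∈ ys) → ∑ φ xs ≤ ∑ (λ a → occ a xs * φ a) ys
  ∑≤∑-occ φ []       {ys} _  = z≤n
  ∑≤∑-occ φ (x ∷ xs) {ys} ⊆ = begin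
    φ x + ∑ φ xs
      ≤⟨ +-mono-≤ (subst (_≤ ∑ δ ys) δx (∈⇒≤∑ δ (⊆ (here refl)))) (∑≤∑-occ φ xs (⊆ ∘ there)) ⟩
    ∑ δ ys + ∑ (λ a → occ a xs * φ a) ys
      ≡⟨ sym (∑-+ δ (λ a → occ a xs * φ a) ys) ⟩
    ∑ (λ a → ind (a ≟ᴬ x) * φ a + occ a xs * φ a) ys
      ≤⟨ ∑-mono ys (λ {a} _ → ≤-reflexive (sym (*-distribʳ-+ (φ a) (ind (a ≟ᴬ x)) (occ a xs)))) ⟩
    ∑ (λ a → occ a (x ∷ xs) * φ a) ys ∎
    where
    open ≤-Reasoning
    δ : A → ℕ
    δ a = ind (a ≟ᴬ x) * φ a

    δx : δ x ≡ φ x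
    δx = trans (cong (_* φ x) (ind-yes (x ≟ᴬ x) refl)) (+-identityʳ (φ x))

  ∑-⊆ : ∀ (φ : A → ℕ) {xs ys} → Unique xs → (∀ {a} → a ∈ xs → a ∈ ys) → ∑ φ xs ≤ ∑ φ ys
  ∑-⊆ φ {xs} {ys} xs! ⊆ = ≤-trans (∑≤∑-occ φ xs ⊆)
    (∑-mono ys (λ {a} _ → ≤-trans (*-monoˡ-≤ (φ a) (occ-Unique a xs!)) (≤-reflexive (+-identityʳ (φ a)))))

  ∑-occ≤length : ∀ xs {ys} → Unique ys → ∑ (λ a → occ a xs) ys ≤ length xs
  ∑-occ≤length []       {ys} ys! = ≤-reflexive (∑-zero ys (λ _ → refl))
  ∑-occ≤length (x ∷ xs) {ys} ys! = ≤-trans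
    (≤-reflexive (∑-+ (λ a → ind (a ≟ᴬ x)) (λ a → occ a xs) ys))
    (+-mono-≤ (∑-supported-once _ ys! (λ a → ind≤1 (a ≟ᴬ x)) (λ ≢0 ≢0' → trans (ind-≟-≢0 ≢0) (sym (ind-≟-≢0 ≢0'))))
      (∑-occ≤length xs ys!))

-- Chains of cells

infix 4 _≟ᶜ_ _≟ᵘ_

_≟ᶜ_ : DecidableEquality Cell
_≟ᶜ_ = PP.≡-dec _≟_ _≟_

_≟ᵘ_ : DecidableEquality Unit
_≟ᵘ_ = PP.≡-dec _≟ᶜ_ _≟_

open Occurrences _≟ᶜ_

private
  module OccUnit = Occurrences _≟ᵘ_

module _ {A : Set} {P : A → Set} (P? : ∀ a → Dec (P a)) where

  ∑-filter : ∀ {B : Set} (φ : B → ℕ) (g : A → B) xs →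
    ∑ φ (map g (filter P? xs)) ≡ ∑ (λ a → ind (P? a) * φ (g a)) xs
  ∑-filter φ g []       = refl
  ∑-filter φ g (x ∷ xs) with does (P? x)
  ... | true  = cong₂ _+_ (sym (+-identityʳ (φ (g x)))) (∑-filter φ g xs)
  ... | false = ∑-filter φ g xs

  length-filter : ∀ xs → length (filter P? xs) ≡ ∑ (ind ∘ P?) xs
  length-filter []       = refl
  length-filter (x ∷ xs) = trans (length-filter-∷ P? x xs) (cong (ind (P? x) +_) (length-filter xs))

AllPairs-deduplicate : ∀ {A : Set} {R Q : Rel A 0ℓ} (R? : ∀ a b → Dec (R a b)) {xs} →
  AllPairs Q xs → AllPairs Q (deduplicate R? xs)
AllPairs-deduplicate R? []       = []
AllPairs-deduplicate R? {x ∷ xs} (p ∷ ps) =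
  AllP.filter⁺ (¬? ∘ R? x) (AllP.deduplicate⁺ R? p) ∷ APP.filter⁺ (¬? ∘ R? x) (AllPairs-deduplicate R? ps)

deduplicate-distinct : ∀ {A : Set} {R : Rel A 0ℓ} (R? : ∀ a b → Dec (R a b)) xs →
  AllPairs (λ a b → ¬ R a b) (deduplicate R? xs)
deduplicate-distinct R? []       = []
deduplicate-distinct R? (x ∷ xs) =
  AllP.all-filter (¬? ∘ R? x) (deduplicate R? xs) ∷ APP.filter⁺ (¬? ∘ R? x) (deduplicate-distinct R? xs)

lookup⇒All : ∀ {A : Set} {P : A → Set} {k} (v : Vec A k) → (∀ p → P (lookup v p)) → All P (toList v)
lookup⇒All []      h = []
lookup⇒All (a ∷ v) h = h zero ∷ lookup⇒All v (h ∘ suc)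

∈-concat-lookup : ∀ {A : Set} {k} (v : Vec (List A) k) {a} → a ∈ concat (toList v) → ∃ λ p → a ∈ lookup v p
∈-concat-lookup (as ∷ v) a∈ with ∈-++⁻ as a∈
... | inj₁ a∈as = zero , a∈as
... | inj₂ a∈v with ∈-concat-lookup v a∈v
...   | p , a∈p = suc p , a∈p

Unique-concat : ∀ {A : Set} {k} (v : Vec (List A) k) → (∀ p → Unique (lookup v p)) →
  (∀ p q → p ≢ q → ∀ a → a ∈ lookup v p → ¬ (a ∈ lookup v q)) → Unique (concat (toList v))
Unique-concat []       _  _ = []
Unique-concat (as ∷ v) us disjoint = UniqueP.++⁺ (us zero)
  (Unique-concat v (us ∘ suc) (λ p q p≢q → disjoint (suc p) (suc q) (λ { refl → p≢q refl })))
  (λ { (a∈as , a∈v) → let p , a∈p = ∈-concat-lookup v a∈v in disjoint zero (suc p) (λ ()) _ a∈as a∈p })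

length-toList : ∀ {A : Set} {k} (v : Vec A k) → length (toList v) ≡ k
length-toList []      = refl
length-toList (a ∷ v) = cong suc (length-toList v)

sum-length : ∀ {A : Set} (xss : List (List A)) → sum (map length xss) ≡ ∑ (λ _ → 1) (concat xss)
sum-length xss = trans (cong sum (map-cong (sym ∘ ∑-one) xss)) (∑-concat (λ _ → 1) xss)

_∈ᶜ?_ : ∀ c cs → Dec (c ∈ cs)
_∈ᶜ?_ = ∈?-gen _≟ᶜ_

#containing : Cell → List (List Cell) → ℕ
#containing c css = length (filter (c ∈ᶜ?_) css)

#containing≤occ : ∀ c css → #containing c css ≤ occ c (concat css)
#containing≤occ c []         = z≤n
#containing≤occ c (cs ∷ css) = begin
  #containing c (cs ∷ css)              ≡⟨ length-filter-∷ (c ∈ᶜ?_) cs css ⟩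
  ind (c ∈ᶜ? cs) + #containing c css    ≤⟨ +-mono-≤ (bound (c ∈ᶜ? cs)) (#containing≤occ c css) ⟩
  occ c cs + occ c (concat css)         ≡⟨ sym (∑-++ _ cs (concat css)) ⟩
  occ c (cs ++ concat css)              ∎
  where
  open ≤-Reasoning
  bound : (c∈? : Dec (c ∈ cs)) → ind c∈? ≤ occ c cs
  bound (yes c∈) = occ-∈ c∈
  bound (no _)   = z≤n

occ≤#containing : ∀ c {css} → All Unique css → occ c (concat css) ≤ #containing c css
occ≤#containing c []                      = z≤n
occ≤#containing c {cs ∷ css} (cs! ∷ css!) = begin
  occ c (cs ++ concat css)              ≡⟨ ∑-++ _ cs (concat css) ⟩
  occ c cs + occ c (concat css)         ≤⟨ +-mono-≤ (bound (c ∈ᶜ? cs)) (occ≤#containing c css!) ⟩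
  ind (c ∈ᶜ? cs) + #containing c css    ≡⟨ sym (length-filter-∷ (c ∈ᶜ?_) cs css) ⟩
  #containing c (cs ∷ css)              ∎
  where
  open ≤-Reasoning
  bound : (c∈? : Dec (c ∈ cs)) → occ c cs ≤ ind c∈?
  bound (yes _) = occ-Unique c cs!
  bound (no c∉) = ≤-reflexive (occ-∉ c∉)

NE-trans : ∀ {c d e} → NE c d → NE d e → NE c e
NE-trans (p , q) (p' , q') = <-trans p p' , <-trans q q'

SE-trans : ∀ {c d e} → SE c d → SE d e → SE c e
SE-trans (p , q) (p' , q') = ≤-trans p p' , ≤-trans q' q

chain-meets-antichain : ∀ {cs ds c d} → AllPairs NE cs → AllPairs SE ds →
  c ∈ cs → d ∈ cs → c ∈ ds → d ∈ ds → c ≡ d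
chain-meets-antichain ne se c∈cs d∈cs c∈ds d∈ds with AllPairs-lookup ne c∈cs d∈cs | AllPairs-lookup se c∈ds d∈ds
... | inj₁ c≡d            | _                      = c≡d
... | inj₂ _              | inj₁ c≡d               = c≡d
... | inj₂ (inj₁ (_ , p)) | inj₂ (inj₁ (_ , q))    = ⊥-elim (<⇒≱ p q)
... | inj₂ (inj₁ (p , _)) | inj₂ (inj₂ (q , _))    = ⊥-elim (<⇒≱ p q)
... | inj₂ (inj₂ (p , _)) | inj₂ (inj₁ (q , _))    = ⊥-elim (<⇒≱ p q)
... | inj₂ (inj₂ (_ , p)) | inj₂ (inj₂ (_ , q))    = ⊥-elim (<⇒≱ p q)

NE⇒Unique : ∀ {cs} → AllPairs NE cs → Unique cs
NE⇒Unique = AllPairs.map (λ { (p , _) refl → <-irrefl refl p })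

module _ {R : List Cell} (R! : Unique R) where

  ∑-meets≤1 : ∀ {cs ds} → AllPairs NE cs → AllPairs SE ds → Unique ds → ∑ (λ c → occ c cs * occ c ds) R ≤ 1
  ∑-meets≤1 {cs} {ds} ne se ds! = ∑-supported-once _ R!
    (λ c → *-mono-≤ (occ-Unique c (NE⇒Unique ne)) (occ-Unique c ds!))
    (λ {c} {d} ≢0 ≢0' → chain-meets-antichain ne se
      (occ-≢0 (λ eq → ≢0 (cong (_* occ c ds) eq))) (occ-≢0 (λ eq → ≢0' (cong (_* occ d ds) eq)))
      (occ-≢0 (λ eq → ≢0 (trans (cong (occ c cs *_) eq) (*-zeroʳ (occ c cs)))))
      (occ-≢0 (λ eq → ≢0' (trans (cong (occ d cs *_) eq) (*-zeroʳ (occ d cs))))))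

  ∑-meets-antichains : ∀ {cs dss} → AllPairs NE cs → All (λ ds → AllPairs SE ds × Unique ds) dss →
    ∑ (λ c → occ c cs * occ c (concat dss)) R ≤ length dss
  ∑-meets-antichains {cs} ne [] = ≤-reflexive (∑-zero R (λ {c} _ → *-zeroʳ (occ c cs)))
  ∑-meets-antichains {cs} {ds ∷ dss} ne ((se , ds!) ∷ ses) = begin
    ∑ (λ c → occ c cs * occ c (ds ++ concat dss)) R
      ≤⟨ ∑-mono R (λ {c} _ → ≤-reflexive (trans (cong (occ c cs *_) (∑-++ _ ds (concat dss)))
           (*-distribˡ-+ (occ c cs) (occ c ds) (occ c (concat dss))))) ⟩
    ∑ (λ c → occ c cs * occ c ds + occ c cs * occ c (concat dss)) R
      ≡⟨ ∑-+ (λ c → occ c cs * occ c ds) _ R ⟩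
    ∑ (λ c → occ c cs * occ c ds) R + ∑ (λ c → occ c cs * occ c (concat dss)) R
      ≤⟨ +-mono-≤ (∑-meets≤1 ne se ds!) (∑-meets-antichains ne ses) ⟩
    suc (length dss) ∎
    where open ≤-Reasoning

  -- The sum counts the common cells of each pair of an NE-chain and an SE-chain, and every pair
  -- contributes at most 1.
  ∑-meets-chains : ∀ {css dss} → All (AllPairs NE) css → All (λ ds → AllPairs SE ds × Unique ds) dss →
    ∑ (λ c → occ c (concat css) * occ c (concat dss)) R ≤ length css * length dss
  ∑-meets-chains []                     ses = ≤-reflexive (∑-zero R (λ _ → refl))
  ∑-meets-chains {cs ∷ css} {dss} (ne ∷ nes) ses = begin
    ∑ (λ c → occ c (cs ++ concat css) * occ c (concat dss)) R
      ≤⟨ ∑-mono R (λ {c} _ → ≤-reflexive (trans (cong (_* occ c (concat dss)) (∑-++ _ cs (concat css)))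
           (*-distribʳ-+ (occ c (concat dss)) (occ c cs) (occ c (concat css))))) ⟩
    ∑ (λ c → occ c cs * occ c (concat dss) + occ c (concat css) * occ c (concat dss)) R
      ≡⟨ ∑-+ (λ c → occ c cs * occ c (concat dss)) _ R ⟩
    ∑ (λ c → occ c cs * occ c (concat dss)) R + ∑ (λ c → occ c (concat css) * occ c (concat dss)) R
      ≤⟨ +-mono-≤ (∑-meets-antichains ne ses) (∑-meets-chains nes ses) ⟩
    length dss + length css * length dss ∎
    where open ≤-Reasoning

-- A cell with a occurrences in chains and b ≤ 1 in antichains.
cell-balance : ∀ {a e} b → a ≤ e → b ≤ 1 → a + b * e ≤ e + a * b
cell-balance {a} {e} zero          a≤e _ = +-mono-≤ a≤e z≤n
cell-balance {a} {e} (suc zero)    _   _ = ≤-reflexive (trans (cong (a +_) (+-identityʳ e))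
  (trans (+-comm a e) (cong (e +_) (sym (*-identityʳ a)))))
cell-balance (suc (suc _)) _ (s≤s ())

-- From coloured units to collections of chains of cells

module Units (hs : List ℕ) (f : Filling) (x y : ℕ) {units : List Unit}
  (good : All (GoodUnit hs f x y) units) (units! : Unique units)
  (complete : ∀ {u} → GoodUnit hs f x y u → u ∈ units) where

  cells : List Cell
  cells = map proj₁ units

  stack : Cell → ℕ → List Unit
  stack c n = map (λ t → c , suc t) (upTo n)

  length-stack : ∀ c n → length (stack c n) ≡ n
  length-stack c n = trans (length-map _ (upTo n)) (length-upTo n)

  occ-cells : ∀ c → occ c cells ≡ ∑ (λ u → ind (c ≟ᶜ proj₁ u)) units
  occ-cells c = cong sum (sym (map-∘ units))

  -- The units lying in `c` are distinct and all belong to its stack of `entryOf f c` units. The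
  -- converse inclusion gives `≤occ-cells`.
  occ-cells≤ : ∀ c → occ c cells ≤ entryOf f c
  occ-cells≤ c = begin
    occ c cells                              ≡⟨ occ-cells c ⟩
    ∑ (λ u → ind (c ≟ᶜ proj₁ u)) units       ≡⟨ sym (length-filter at? units) ⟩
    length (filter at? units)                ≡⟨ sym (∑-one (filter at? units)) ⟩
    ∑ (λ _ → 1) (filter at? units)           ≤⟨ OccUnit.∑-⊆ _ (UniqueP.filter⁺ at? units!) inStack ⟩
    ∑ (λ _ → 1) (stack c (entryOf f c))      ≡⟨ ∑-one (stack c (entryOf f c)) ⟩
    length (stack c (entryOf f c))           ≡⟨ length-stack c (entryOf f c) ⟩
    entryOf f c                              ∎
    where
    open ≤-Reasoning
    at? : ∀ u → Dec (c ≡ proj₁ u)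
    at? u = c ≟ᶜ proj₁ u

    inStack : ∀ {u} → u ∈ filter at? units → u ∈ stack c (entryOf f c)
    inStack {u} u∈ with ∈-filter⁻ at? {xs = units} u∈
    inStack {_ , zero}  u∈ | u∈units , refl with All.lookup good u∈units
    ... | _ , () , _
    inStack {_ , suc t} u∈ | u∈units , refl with All.lookup good u∈units
    ... | _ , _ , t<f = ∈-map⁺ _ (∈-upTo⁺ t<f)

  ≤occ-cells : ∀ {c} → InR hs x y c → entryOf f c ≤ occ c cells
  ≤occ-cells {c} inR = begin
    entryOf f c                                        ≡⟨ sym (length-stack c (entryOf f c)) ⟩
    length (stack c (entryOf f c))                     ≡⟨ sym (∑-one (stack c (entryOf f c))) ⟩
    ∑ (λ _ → 1) (stack c (entryOf f c))                ≤⟨ ∑-mono (stack c (entryOf f c)) atCell ⟩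
    ∑ (λ u → ind (c ≟ᶜ proj₁ u)) (stack c (entryOf f c)) ≤⟨ OccUnit.∑-⊆ _ stack! inUnits ⟩
    ∑ (λ u → ind (c ≟ᶜ proj₁ u)) units                 ≡⟨ sym (occ-cells c) ⟩
    occ c cells                                        ∎
    where
    open ≤-Reasoning
    stack! : Unique (stack c (entryOf f c))
    stack! = UniqueP.map⁺ (λ { refl → refl }) (UniqueP.upTo⁺ (entryOf f c))

    atCell : ∀ {u} → u ∈ stack c (entryOf f c) → 1 ≤ ind (c ≟ᶜ proj₁ u)
    atCell u∈ with ∈-map⁻ _ u∈
    ... | _ , _ , refl = ≤-reflexive (sym (ind-yes (c ≟ᶜ c) refl))

    inUnits : ∀ {u} → u ∈ stack c (entryOf f c) → u ∈ units
    inUnits u∈ with ∈-map⁻ _ u∈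
    ... | _ , t∈ , refl = complete (inR , s≤s z≤n , ∈-upTo⁻ t∈)

  GoodUnit⇒GoodCell : ∀ {u} → GoodUnit hs f x y u → GoodCell hs f x y (proj₁ u)
  GoodUnit⇒GoodCell (inR , 1≤t , t≤f) = inR , λ f≡0 → <⇒≱ (≤-trans 1≤t t≤f) (≤-reflexive f≡0)

  NEChain⇒AllPairs : ∀ {cs} → IsNEChain hs f x y cs → AllPairs NE cs
  NEChain⇒AllPairs (_ , linked) = Linked⇒AllPairs NE-trans (Linked.map id linked)

  SEChain⇒AllPairs : ∀ {cs} → IsSEChain hs f x y cs → AllPairs SE cs
  SEChain⇒AllPairs (_ , linked , _) = Linked⇒AllPairs SE-trans (Linked.map id linked)

  -- `cell-balance` is summed over the distinct cells in `R`. The entries then add up to at most the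
  -- number of units, and the products count the meetings of chains with antichains.
  chains-antichains : ∀ {k l} chs dhs → NECollection hs f x y k chs → SECollection hs f x y l dhs →
    sum (map length (toList chs)) + sum (map (seLength f) (toList dhs)) ≤ length units + k * l
  chains-antichains {k} {l} chs dhs (ne , mult) (se , disjoint) = begin
    sum (map length css) + sum (map (seLength f) dss)
      ≡⟨ cong₂ _+_ (sum-length css) (∑-concat (entryOf f) dss) ⟩
    ∑ (λ _ → 1) (concat css) + ∑ (entryOf f) (concat dss)
      ≤⟨ +-mono-≤ (∑≤∑-occ _ (concat css) (inR chs (proj₁ ∘ ne))) (∑≤∑-occ _ (concat dss) (inR dhs (proj₁ ∘ se))) ⟩
    ∑ (λ c → a c * 1) R + ∑ (λ c → b c * entryOf f c) R
      ≡⟨ sym (∑-+ (λ c → a c * 1) _ R) ⟩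
    ∑ (λ c → a c * 1 + b c * entryOf f c) R
      ≤⟨ ∑-mono R (λ {c} _ → subst (λ h → h + b c * entryOf f c ≤ entryOf f c + a c * b c) (sym (*-identityʳ (a c)))
           (cell-balance (b c) (≤-trans (occ≤#containing c css!) (mult c)) (occ-Unique c dss!))) ⟩
    ∑ (λ c → entryOf f c + a c * b c) R
      ≡⟨ ∑-+ (entryOf f) _ R ⟩
    ∑ (entryOf f) R + ∑ (λ c → a c * b c) R
      ≤⟨ +-mono-≤ total (∑-meets-chains R! (lookup⇒All chs (NEChain⇒AllPairs ∘ ne))
           (lookup⇒All dhs (λ p → SEChain⇒AllPairs (se p) , proj₂ (proj₂ (se p))))) ⟩
    length units + length css * length dss
      ≡⟨ cong₂ (λ p q → length units + p * q) (length-toList chs) (length-toList dhs) ⟩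
    length units + k * l ∎
    where
    open ≤-Reasoning
    css = toList chs
    dss = toList dhs

    R : List Cell
    R = deduplicate _≟ᶜ_ cells

    R! : Unique R
    R! = deduplicate-! _≟ᶜ_ cells

    a b : Cell → ℕ
    a c = occ c (concat css)
    b c = occ c (concat dss)

    css! : All Unique css
    css! = lookup⇒All chs (NE⇒Unique ∘ NEChain⇒AllPairs ∘ ne)

    dss! : Unique (concat dss)
    dss! = Unique-concat dhs (λ p → proj₂ (proj₂ (se p))) disjoint

    inR : ∀ {k} (v : Vec (List Cell) k) → (∀ p → All (GoodCell hs f x y) (lookup v p)) →
          ∀ {c} → c ∈ concat (toList v) → c ∈ R
    inR v h {c} c∈ with ∈-concat-lookup v c∈
    ... | p , c∈p with All.lookup (h p) c∈p
    ...   | inR , f≢0 = ∈-deduplicate⁺ _≟ᶜ_ (∈-map⁺ proj₁ (complete {c , 1} (inR , s≤s z≤n , n≢0⇒n>0 f≢0)))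

    total : ∑ (entryOf f) R ≤ length units
    total = begin
      ∑ (entryOf f) R          ≤⟨ ∑-mono R (λ c∈ → ≤occ-cells (inRegion (∈-map⁻ proj₁ (∈-deduplicate⁻ _≟ᶜ_ cells c∈)))) ⟩
      ∑ (λ c → occ c cells) R  ≤⟨ ∑-occ≤length cells R! ⟩
      length cells             ≡⟨ length-map proj₁ units ⟩
      length units             ∎
      where
      inRegion : ∀ {c} → (∃ λ u → u ∈ units × c ≡ proj₁ u) → InR hs x y c
      inRegion (u , u∈ , refl) = proj₁ (All.lookup good u∈)

  cell : Unit × ℕ → Cell
  cell = proj₁ ∘ proj₁

  module ColourClasses (ds : List (Unit × ℕ)) where

    chain : ℕ → List Cell
    chain q = map cell (filter (λ d → proj₂ d ≟ q) ds)

    chains : ∀ k → Vec (List Cell) k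
    chains zero    = []
    chains (suc k) = chain k ∷ chains k

    lookup-chains : ∀ k p → ∃ λ q → q < k × lookup (chains k) p ≡ chain q
    lookup-chains (suc k) zero    = k , ≤-refl , refl
    lookup-chains (suc k) (suc p) with lookup-chains k p
    ... | q , q<k , eq = q , m≤n⇒m≤1+n q<k , eq

    ind-suc : ∀ c k → ind (c ≟ k) + ind (c <? k) ≡ ind (c <? suc k)
    ind-suc c k with <-cmp c k
    ... | tri< c<k c≢k _ = trans (cong₂ _+_ (ind-no (c ≟ k) c≢k) (ind-yes (c <? k) c<k))
                                 (sym (ind-yes (c <? suc k) (m≤n⇒m≤1+n c<k)))
    ... | tri≈ c≮k refl _ = trans (cong₂ _+_ (ind-yes (c ≟ c) refl) (ind-no (c <? c) c≮k))
                                 (sym (ind-yes (c <? suc c) ≤-refl))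
    ... | tri> c≮k c≢k k<c = trans (cong₂ _+_ (ind-no (c ≟ k) c≢k) (ind-no (c <? k) c≮k))
                                 (sym (ind-no (c <? suc k) (<⇒≱ (s≤s k<c))))

    -- One identity for three uses: constant 1 gives the number of cells in the chains, the
    -- indicator of a cell its multiplicity, and the entry the total of SE-lengths.
    ∑-chains : ∀ φ k → ∑ φ (concat (toList (chains k))) ≡ ∑ (λ d → ind (proj₂ d <? k) * φ (cell d)) ds
    ∑-chains φ zero    = sym (∑-zero ds (λ _ → refl))
    ∑-chains φ (suc k) = begin
      ∑ φ (chain k ++ concat (toList (chains k)))
        ≡⟨ ∑-++ φ (chain k) _ ⟩
      ∑ φ (chain k) + ∑ φ (concat (toList (chains k)))
        ≡⟨ cong₂ _+_ (∑-filter (λ d → proj₂ d ≟ k) φ cell ds) (∑-chains φ k) ⟩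
      ∑ (λ d → ind (proj₂ d ≟ k) * φ (cell d)) ds + ∑ (λ d → ind (proj₂ d <? k) * φ (cell d)) ds
        ≡⟨ sym (∑-+ (λ d → ind (proj₂ d ≟ k) * φ (cell d)) _ ds) ⟩
      ∑ (λ d → ind (proj₂ d ≟ k) * φ (cell d) + ind (proj₂ d <? k) * φ (cell d)) ds
        ≡⟨ cong sum (map-cong (λ d → trans (sym (*-distribʳ-+ (φ (cell d)) (ind (proj₂ d ≟ k)) (ind (proj₂ d <? k))))
             (cong (_* φ (cell d)) (ind-suc (proj₂ d) k))) ds) ⟩
      ∑ (λ d → ind (proj₂ d <? suc k) * φ (cell d)) ds ∎
      where open ≡-Reasoning

    chain-All : ∀ {P : Cell → Set} q → All (P ∘ cell) ds → All P (chain q)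
    chain-All q ps = AllP.map⁺ (AllP.filter⁺ (λ d → proj₂ d ≟ q) ps)

    chain-AllPairs : ∀ {_~_ : Rel Cell 0ℓ} {k q} → q < k →
      AllPairs (λ (u , c) (u' , c') → c ≡ c' → c < k → proj₁ u ~ proj₁ u') ds → AllPairs _~_ (chain q)
    chain-AllPairs {q = q} q<k ps = APP.map⁺ (AllPairs.map
      (λ { (refl , eq , r) → r (sym eq) q<k })
      (AllPairs-with (AllP.all-filter (λ d → proj₂ d ≟ q) ds) (APP.filter⁺ (λ d → proj₂ d ≟ q) ps)))

  NE-collection : ∀ {k n} → Coloured (NE on proj₁) k n units →
    ∃ λ chs → NECollection hs f x y k chs × sum (map length (toList chs)) ≡ n
  NE-collection {k} {n} (ds , ds-units , ps , count) = chains k , (isChain , multiplicity≤) , total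
    where
    open ColourClasses ds

    good-ds : All (GoodCell hs f x y ∘ cell) ds
    good-ds = All.map GoodUnit⇒GoodCell (AllP.map⁻ (subst (All (GoodUnit hs f x y)) (sym ds-units) good))

    isChain : ∀ p → IsNEChain hs f x y (lookup (chains k) p)
    isChain p with lookup-chains k p
    ... | q , q<k , eq = subst (IsNEChain hs f x y) (sym eq)
      (chain-All q good-ds , Linked.map id (AllPairs⇒Linked (chain-AllPairs {NE} q<k ps)))

    multiplicity≤ : ∀ c → multiplicity c (chains k) ≤ entryOf f c
    multiplicity≤ c = begin
      multiplicity c (chains k)                                   ≤⟨ #containing≤occ c (toList (chains k)) ⟩
      occ c (concat (toList (chains k)))                          ≡⟨ ∑-chains _ k ⟩
      ∑ (λ d → ind (proj₂ d <? k) * ind (c ≟ᶜ cell d)) ds         ≤⟨ ∑-mono ds (λ {d} _ →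
        ≤-trans (*-monoˡ-≤ (ind (c ≟ᶜ cell d)) (ind≤1 (proj₂ d <? k))) (≤-reflexive (+-identityʳ _))) ⟩
      ∑ (λ d → ind (c ≟ᶜ cell d)) ds                              ≡⟨ cong sum (map-∘ ds) ⟩
      ∑ (λ u → ind (c ≟ᶜ proj₁ u)) (map proj₁ ds)                 ≡⟨ cong (∑ _) ds-units ⟩
      ∑ (λ u → ind (c ≟ᶜ proj₁ u)) units                          ≡⟨ sym (occ-cells c) ⟩
      occ c cells                                                 ≤⟨ occ-cells≤ c ⟩
      entryOf f c                                                 ∎
      where open ≤-Reasoning

    total : sum (map length (toList (chains k))) ≡ n
    total = trans (sum-length (toList (chains k))) (trans (∑-chains _ k)
      (trans (cong sum (map-cong (λ d → *-identityʳ (ind (proj₂ d <? k))) ds)) count))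

  -- Each cell with a unit in some chain goes, with all its units, to the chain of the
  -- first such unit.
  SE-collection : ∀ {l n} → Coloured (SE on proj₁) l n units →
    ∃ λ chs → SECollection hs f x y l chs × n ≤ sum (map (seLength f) (toList chs))
  SE-collection {l} {n} (ds , ds-units , ps , count) = chains l , (isChain , disjoint) , total
    where
    active? : ∀ (d : Unit × ℕ) → Dec (proj₂ d < l)
    active? d = proj₂ d <? l

    same? : ∀ (d e : Unit × ℕ) → Dec (cell d ≡ cell e)
    same? d e = cell d ≟ᶜ cell e

    ds⁺ es : List (Unit × ℕ)
    ds⁺ = filter active? ds
    es = deduplicate same? ds⁺

    open ColourClasses es

    good-es : All (GoodCell hs f x y ∘ cell) es
    good-es = AllP.deduplicate⁺ same? (AllP.filter⁺ active?
      (All.map GoodUnit⇒GoodCell (AllP.map⁻ (subst (All (GoodUnit hs f x y)) (sym ds-units) good))))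

    es-distinct : AllPairs (λ d e → cell d ≢ cell e) es
    es-distinct = deduplicate-distinct same? ds⁺

    isChain : ∀ p → IsSEChain hs f x y (lookup (chains l) p)
    isChain p with lookup-chains l p
    ... | q , q<l , eq = subst (IsSEChain hs f x y) (sym eq)
      ( chain-All q good-es
      , Linked.map id (AllPairs⇒Linked (chain-AllPairs {SE} q<l (AllPairs-deduplicate same? (APP.filter⁺ active? ps))))
      , APP.map⁺ (APP.filter⁺ (λ d → proj₂ d ≟ q) es-distinct))

    colour-determined : ∀ {c q r} → c ∈ chain q → c ∈ chain r → q ≡ r
    colour-determined {q = q} {r} c∈q c∈r with ∈-map⁻ cell c∈q | ∈-map⁻ cell c∈r
    ... | d , d∈ , refl | e , e∈ , eq with ∈-filter⁻ (λ d → proj₂ d ≟ q) {xs = es} d∈ | ∈-filter⁻ (λ d → proj₂ d ≟ r) {xs = es} e∈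
    ...   | d∈es , refl | e∈es , refl with AllPairs-lookup es-distinct d∈es e∈es
    ...     | inj₁ refl      = refl
    ...     | inj₂ (inj₁ ≢e) = ⊥-elim (≢e eq)
    ...     | inj₂ (inj₂ ≢d) = ⊥-elim (≢d (sym eq))

    disjoint-chains : ∀ k (p q : Fin k) → p ≢ q → ∀ c → c ∈ lookup (chains k) p → ¬ (c ∈ lookup (chains k) q)
    disjoint-chains (suc k) zero    zero    p≢q c _   _   = p≢q refl
    disjoint-chains (suc k) zero    (suc q) p≢q c c∈p c∈q with lookup-chains k q
    ... | r , r<k , eq = <⇒≢ r<k (sym (colour-determined c∈p (subst (c ∈_) eq c∈q)))
    disjoint-chains (suc k) (suc p) zero    p≢q c c∈p c∈q with lookup-chains k p
    ... | r , r<k , eq = <⇒≢ r<k (colour-determined (subst (c ∈_) eq c∈p) c∈q)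
    disjoint-chains (suc k) (suc p) (suc q) p≢q c c∈p c∈q = disjoint-chains k p q (λ { refl → p≢q refl }) c c∈p c∈q

    disjoint : ∀ (p q : Fin l) → p ≢ q → ∀ c → c ∈ lookup (chains l) p → ¬ (c ∈ lookup (chains l) q)
    disjoint = disjoint-chains l

    represented : ∀ {c} → c ∈ map cell ds⁺ → c ∈ map cell es
    represented c∈ with ∈-map⁻ cell c∈
    ... | d , d∈ , refl = AnyP.map⁺ (AnyP.deduplicate⁺ same? (λ eq → λ eq' → trans eq' (sym eq)) (Any.map (cong cell) d∈))

    occ-ds⁺≤ : ∀ c → occ c (map cell ds⁺) ≤ entryOf f c
    occ-ds⁺≤ c = begin
      occ c (map cell ds⁺)                                        ≡⟨ ∑-filter active? _ cell ds ⟩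
      ∑ (λ d → ind (active? d) * ind (c ≟ᶜ cell d)) ds            ≤⟨ ∑-mono ds (λ {d} _ →
        ≤-trans (*-monoˡ-≤ (ind (c ≟ᶜ cell d)) (ind≤1 (active? d))) (≤-reflexive (+-identityʳ _))) ⟩
      ∑ (λ d → ind (c ≟ᶜ cell d)) ds                              ≡⟨ cong sum (map-∘ ds) ⟩
      ∑ (λ u → ind (c ≟ᶜ proj₁ u)) (map proj₁ ds)                 ≡⟨ cong (∑ _) ds-units ⟩
      ∑ (λ u → ind (c ≟ᶜ proj₁ u)) units                          ≡⟨ sym (occ-cells c) ⟩
      occ c cells                                                 ≤⟨ occ-cells≤ c ⟩
      entryOf f c                                                 ∎
      where open ≤-Reasoning

    -- Each coloured unit is charged to its cell, which holds at most its entry of them. The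
    -- inequality can be strict, because a represented cell also brings its units without an active
    -- colour.
    total : n ≤ sum (map (seLength f) (toList (chains l)))
    total = begin
      n                                                     ≡⟨ sym count ⟩
      ∑ (ind ∘ active?) ds                                  ≡⟨ sym (length-filter active? ds) ⟩
      length ds⁺                                            ≡⟨ sym (length-map cell ds⁺) ⟩
      length (map cell ds⁺)                                 ≡⟨ sym (∑-one (map cell ds⁺)) ⟩
      ∑ (λ _ → 1) (map cell ds⁺)                            ≤⟨ ∑≤∑-occ _ (map cell ds⁺) represented ⟩
      ∑ (λ c → occ c (map cell ds⁺) * 1) (map cell es)      ≤⟨ ∑-mono (map cell es) (λ {c} _ →
        ≤-trans (≤-reflexive (*-identityʳ _)) (occ-ds⁺≤ c)) ⟩
      ∑ (entryOf f) (map cell es)                           ≡⟨ cong sum (sym (map-∘ es)) ⟩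
      ∑ (entryOf f ∘ cell) es                               ≤⟨ ∑-mono es (λ {d} d∈ → ≤-reflexive (sym (trans
        (cong (_* entryOf f (cell d)) (ind-yes (active? d) (All.lookup es-active d∈))) (+-identityʳ _)))) ⟩
      ∑ (λ d → ind (proj₂ d <? l) * entryOf f (cell d)) es  ≡⟨ sym (∑-chains (entryOf f) l) ⟩
      ∑ (entryOf f) (concat (toList (chains l)))            ≡⟨ sym (∑-concat (entryOf f) (toList (chains l))) ⟩
      sum (map (seLength f) (toList (chains l)))            ∎
      where
      open ≤-Reasoning
      es-active : All (λ d → proj₂ d < l) es
      es-active = AllP.deduplicate⁺ same? (AllP.all-filter active? ds)

-- Both maxima from existence and the counting bound

module Maxima (hs : List ℕ) (f : Filling) (x y : ℕ) (shape : Partition) (X : ℕ) where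

  L : ℕ → ℕ
  L = heightAt shape

  NEtotal SEtotal : ∀ {k} → Vec (List Cell) k → ℕ
  NEtotal chs = sum (map length (toList chs))
  SEtotal chs = sum (map (seLength f) (toList chs))

  module MaximaOf
    (L-decreasing : ∀ i → L (suc (suc i)) ≤ L (suc i))
    (L-vanishes : ∀ i → X ≤ i → L (suc i) ≡ 0)
    (NE-exists : ∀ k → ∃ λ chs → NECollection hs f x y k chs × NEtotal chs ≡ sumTo k L)
    (SE-exists : ∀ l n → X ≤ n → ∃ λ chs → SECollection hs f x y l chs × sumTo n (λ i → L i ⊓ l) ≤ SEtotal chs)
    (NE-SE-bound : ∀ {k l} n → X ≤ n → ∀ chs dhs → NECollection hs f x y k chs → SECollection hs f x y l dhs →
                   NEtotal chs + SEtotal dhs ≤ sumTo n L + k * l)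
    where

    open Decreasing L L-decreasing

    duality : ∀ {k l} n → X ≤ n → Touches k l → k ≤ n →
      ∀ chs dhs → NECollection hs f x y k chs → SECollection hs f x y l dhs →
      NEtotal chs + SEtotal dhs ≤ sumTo n (λ i → L i ⊓ l) + sumTo k L
    duality {k} {l} n X≤n touches k≤n chs dhs ne se = begin
      NEtotal chs + SEtotal dhs                ≤⟨ NE-SE-bound n X≤n chs dhs ne se ⟩
      sumTo n L + k * l                        ≡⟨ sym (touches-sum n k≤n touches) ⟩
      sumTo n (λ i → L i ⊓ l) + sumTo k L      ∎
      where open ≤-Reasoning

    NE-maximum : ∀ k → 1 ≤ k → MaxOf (NECollection hs f x y k) NEtotal (partSum k shape)
    NE-maximum (suc k) _ = subst (MaxOf _ NEtotal) (sym (partSum≡sumTo (suc k) shape)) (NE-exists (suc k) , upper)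
      where
      -- Large enough to cover all nonzero parts and to include row `suc k`, which may lie beyond
      -- them.
      n = X + suc k
      l = L (suc k)

      upper : ∀ chs → NECollection hs f x y (suc k) chs → NEtotal chs ≤ sumTo (suc k) L
      upper chs ne with SE-exists l n (m≤m+n (X) (suc k))
      ... | dhs , se , l≤SE = +-cancelˡ-≤ (sumTo n (λ i → L i ⊓ l)) _ _ (begin
        sumTo n (λ i → L i ⊓ l) + NEtotal chs  ≤⟨ +-monoˡ-≤ (NEtotal chs) l≤SE ⟩
        SEtotal dhs + NEtotal chs              ≡⟨ +-comm (SEtotal dhs) (NEtotal chs) ⟩
        NEtotal chs + SEtotal dhs              ≤⟨ duality n (m≤m+n (X) (suc k)) (touches-part k)
                                                    (m≤n+m (suc k) (X)) chs dhs ne se ⟩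
        sumTo n (λ i → L i ⊓ l) + sumTo (suc k) L ∎)
        where open ≤-Reasoning

    SE-maximum : ∀ l → MaxOf (SECollection hs f x y l) SEtotal (partSum l (conj shape))
    SE-maximum l = subst (MaxOf _ SEtotal) (sym (partSum-conj l (X) shape L-decreasing L-vanishes)) (attained , upper)
      where
      S = sumTo (X) (λ i → L i ⊓ l)

      upper : ∀ dhs → SECollection hs f x y l dhs → SEtotal dhs ≤ S
      upper dhs se with touching-row l (X) L-vanishes
      ... | k , k≤X , touches with NE-exists k
      ...   | chs , ne , NE≡ = +-cancelˡ-≤ (sumTo k L) _ _ (begin
        sumTo k L + SEtotal dhs    ≡⟨ cong (_+ SEtotal dhs) (sym NE≡) ⟩
        NEtotal chs + SEtotal dhs  ≤⟨ duality (X) ≤-refl touches k≤X chs dhs ne se ⟩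
        S + sumTo k L              ≡⟨ +-comm S _ ⟩
        sumTo k L + S              ∎)
        where open ≤-Reasoning

      -- Existence only gives a collection of total at least `S`; the upper bound makes it exact.
      attained : ∃ λ dhs → SECollection hs f x y l dhs × SEtotal dhs ≡ S
      attained with SE-exists l (X) ≤-refl
      ... | dhs , se , S≤ = dhs , se , ≤-antisym (upper dhs se) S≤

    NE-longest : MaxOf (IsNEChain hs f x y) length (partSum 1 shape)
    NE-longest with NE-maximum 1 ≤-refl
    ... | (cs ∷ [] , (ne , _) , total) , upper =
      (cs , ne zero , trans (sym (+-identityʳ (length cs))) total) ,
      λ cs ne → subst (_≤ partSum 1 shape) (+-identityʳ (length cs))
        (upper (cs ∷ []) ((λ { zero → ne }) , single cs ne))
      where
      -- A lone chain meets the multiplicity bound since its cells have nonzero entries.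
      single : ∀ cs → IsNEChain hs f x y cs → ∀ c → multiplicity c (cs ∷ []) ≤ entryOf f c
      single cs ne c = ≤-trans
        (≤-reflexive (trans (length-filter-∷ (c ∈ᶜ?_) cs []) (+-identityʳ (ind (c ∈ᶜ? cs))))) (bound (c ∈ᶜ? cs))
        where
        bound : (c∈? : Dec (c ∈ cs)) → ind c∈? ≤ entryOf f c
        bound (yes c∈) = n≢0⇒n>0 (proj₂ (All.lookup (proj₁ ne) c∈))
        bound (no _)   = z≤n

    SE-longest : MaxOf (IsSEChain hs f x y) (seLength f) (partSum 1 (conj shape))
    SE-longest with SE-maximum 1
    ... | (cs ∷ [] , (se , _) , total) , upper =
      (cs , se zero , trans (sym (+-identityʳ (seLength f cs))) total) ,
      λ cs se → subst (_≤ partSum 1 (conj shape)) (+-identityʳ (seLength f cs))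
        (upper (cs ∷ []) ((λ { zero → se }) , λ { zero zero p≢q → ⊥-elim (p≢q refl) }))

theorem12 : (hs : List ℕ) → IsFerrers hs → (f : Filling) → (x y : ℕ) → IsCorner hs x y →
    ((k : ℕ) → 1 ≤ k →
    MaxOf (NECollection hs f x y k) (λ chs → sum (map length (toList chs)))
    (partSum k (dualRSKLabel hs f x y)))
    × ((k : ℕ) → 1 ≤ k →
    MaxOf (SECollection hs f x y k) (λ chs → sum (map (seLength f) (toList chs)))
    (partSum k (conj (dualRSKLabel hs f x y))))
    × MaxOf (IsNEChain hs f x y) length (partSum 1 (dualRSKLabel hs f x y))
    × MaxOf (IsSEChain hs f x y) (seLength f) (partSum 1 (conj (dualRSKLabel hs f x y)))
theorem12 hs _ f x y _ = NE-maximum , (λ l _ → SE-maximum l) , NE-longest , SE-longest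
  where
  open Separation hs f using (gFill-IsPartialPermutation; module AtCorner)
  open AtCorner x y
  open Greene gFill-IsPartialPermutation using (part-decreasing; part≡0)
  open Units hs f x y units-Good units-Unique units-complete
  X = DualRSK.Xend hs f x
  Y = DualRSK.Yend hs f y
  open Maxima hs f x y (dualRSKLabel hs f x y) X

  bound : ∀ {k l} n → X ≤ n → ∀ chs dhs → NECollection hs f x y k chs → SECollection hs f x y l dhs →
          NEtotal chs + SEtotal dhs ≤ sumTo n L + k * l
  bound {k} {l} n X≤n chs dhs ne se = subst (λ h → NEtotal chs + SEtotal dhs ≤ h + k * l) (length-units n X≤n)
    (chains-antichains chs dhs ne se)

  open MaximaOf (part-decreasing X Y) (part≡0 X Y) (λ k → NE-collection (NE-units k))
    (λ l n X≤n → SE-collection (SE-units l n X≤n)) bound
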